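{- Let $\alpha\ge1$ and let $H_1,\dots,H_k$ be subgraphs of $G$ such that each $H_i$ is a subsetwise $R_i\times R_i$ $\alpha$-spanner of $G$. Then one can compute in polynomial time (given $H_1,\dots,H_k$) a group Steiner $(2\alpha+1)$-spanner of $G$ w.r.t. $\mathcal{R}$ with $O\big(nk+|\bigcup_{i=1}^kH_i|\big)$ edges.
   Context: $G=(V,E)$ is a connected undirected graph on $n$ vertices with non-negative edge weights. $\mathcal{R}=\{R_1,\dots,R_k\}$ is a collection of $k$ non-empty subsets of $V$. Paths are walks; lengths count edge weights with multiplicity. $d_X$ denotes shortest-path distance in graph $X$. For $S\subseteq V$, a subsetwise $S\times S$ $\alpha$-spanner of $G$ is a subgraph $H'$ with $d_{H'}(u,v)\le\alpha d_G(u,v)$ for all $u,v\in S$. A group Steiner path from $s$ to $t$ is a path from $s$ to $t$ containing at least one vertex of each $R_i$; $\sigma_X(s,t)$ is its minimum length in $X$. A group Steiner $\beta$-spanner of $G$ is a spanning subgraph $H$ with $\sigma_H(s,t)\le\beta\sigma_G(s,t)$ for all $s,t\in V$. $|X|$ is the number of edges of $X$. -}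

module Defs where

open import Level using (Level; _⊔_) renaming (suc to lsuc)
open import Algebra.Bundles using (CommutativeRing)
open import Data.Bool using (Bool; true; false; T; not; _∧_; if_then_else_)
open import Data.Bool.ListAction using (any)
open import Data.Fin using (Fin; toℕ; fromℕ<)
open import Data.Fin.Subset using (Subset; _∈_)
open import Data.List using (List; []; _∷_; length; filterᵇ; allFin; cartesianProduct)
open import Data.List.Properties using (≡-dec)
open import Data.Nat as ℕ using (ℕ; zero; suc; _<ᵇ_; _≤ᵇ_; _∸_)
open import Data.Product using (∃; ∃₂; _×_; _,_)
open import Data.Unit using (⊤)
open import Data.Vec using (lookup)
open import Relation.Binary.PropositionalEquality using (_≡_)
open import Relation.Binary.Structures using (IsDecTotalOrder)
open import Relation.Nullary using (¬_; yes; no)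
open import Relation.Nullary.Decidable using (⌊_⌋)

private
  variable
    c ℓ₁ ℓ₂ : Level
    n k : ℕ

-- The domain of edge weights and stretch factors: a commutative ring with a
-- compatible decidable total order.  It stands in for the real numbers, which
-- the library lacks; ℤ, ℚ and (classically) ℝ are all models.

record OrderedCommutativeRing c ℓ₁ ℓ₂ : Set (lsuc (c ⊔ ℓ₁ ⊔ ℓ₂)) where
  infix 4 _≤_
  field
    commutativeRing : CommutativeRing c ℓ₁
  open CommutativeRing commutativeRing public
  field
    _≤_             : Carrier → Carrier → Set ℓ₂
    isDecTotalOrder : IsDecTotalOrder _≈_ _≤_
    +-monoʳ-≤       : ∀ z {x y} → x ≤ y → z + x ≤ z + y
    *-nonNegative   : ∀ {x y} → 0# ≤ x → 0# ≤ y → 0# ≤ x * y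
  open IsDecTotalOrder isDecTotalOrder public using (_≤?_)

------------------------------------------------------------------------
-- Graphs, subgraphs, walks

-- A finite simple undirected graph on Fin n with non-negative edge weights.
-- `weight` is meaningful only on pairs that are edges.

record Graph (K : OrderedCommutativeRing c ℓ₁ ℓ₂) (n : ℕ) : Set (c ⊔ ℓ₁ ⊔ ℓ₂) where
  open OrderedCommutativeRing K
  field
    edge          : Fin n → Fin n → Bool
    edge-sym      : ∀ u v → edge u v ≡ edge v u
    edge-irrefl   : ∀ v → ¬ T (edge v v)
    weight        : Fin n → Fin n → Carrier
    weight-sym    : ∀ u v → T (edge u v) → weight u v ≈ weight v u
    weight-nonNeg : ∀ u v → T (edge u v) → 0# ≤ weight u v

-- Edges of a subgraph carry the weights of the ambient graph.

record Subgraph {K : OrderedCommutativeRing c ℓ₁ ℓ₂} (G : Graph K n) : Set where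
  field
    vertices : Subset n
    edge     : Fin n → Fin n → Bool
    edge-sym : ∀ u v → edge u v ≡ edge v u
    edge-end : ∀ u v → T (edge u v) → u ∈ vertices
    edge-⊆   : ∀ u v → T (edge u v) → T (Graph.edge G u v)

edgeCount : (Fin n → Fin n → Bool) → ℕ
edgeCount {n} e =
  length (filterᵇ (λ (u , v) → (toℕ u <ᵇ toℕ v) ∧ e u v)
                  (cartesianProduct (allFin n) (allFin n)))

module _ {K : OrderedCommutativeRing c ℓ₁ ℓ₂} {G : Graph K n} where
  open OrderedCommutativeRing K
  open Graph G using (weight)

  IsSpanning : Subgraph G → Set
  IsSpanning X = ∀ v → v ∈ Subgraph.vertices X

  ∣_∣ᴱ : Subgraph G → ℕ
  ∣ X ∣ᴱ = edgeCount (Subgraph.edge X)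

  ∣⋃_∣ᴱ : (Fin k → Subgraph G) → ℕ
  ∣⋃_∣ᴱ {k} Xs = edgeCount (λ u v → any (λ i → Subgraph.edge (Xs i) u v) (allFin k))

  data Walk (X : Subgraph G) : Fin n → Fin n → Set where
    stop : ∀ {u} → u ∈ Subgraph.vertices X → Walk X u u
    step : ∀ {u v t} → T (Subgraph.edge X u v) → Walk X v t → Walk X u t

  walkLength : ∀ {X s t} → Walk X s t → Carrier
  walkLength (stop _)           = 0#
  walkLength (step {u} {v} _ p) = weight u v + walkLength p

  data Visits {X : Subgraph G} (x : Fin n) : ∀ {s t} → Walk X s t → Set where
    at-stop : ∀ {x∈X} → Visits x (stop {u = x} x∈X)
    at-step : ∀ {v t e} {p : Walk X v t} → Visits x (step {u = x} e p)
    later   : ∀ {u v t} {e : T (Subgraph.edge X u v)} {p : Walk X v t} →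
              Visits x p → Visits x (step e p)

  IsGroupSteiner : (Fin k → Subset n) → ∀ {X s t} → Walk X s t → Set
  IsGroupSteiner Rs p = ∀ i → ∃ λ v → v ∈ Rs i × Visits v p

  IsMinLength : ∀ X s t → (Walk X s t → Set) → Carrier → Set (ℓ₁ ⊔ ℓ₂)
  IsMinLength X s t P d =
    (∃ λ (p : Walk X s t) → P p × walkLength p ≈ d) ×
    (∀ (p : Walk X s t) → P p → d ≤ walkLength p)

  -- IsDist X s t d  is  d_X(s,t) = d;  it holds for no d if s, t are not
  -- connected in X (infinite distance).  Likewise  IsSteinerDist  for σ_X(s,t).

  IsDist : Subgraph G → Fin n → Fin n → Carrier → Set (ℓ₁ ⊔ ℓ₂)
  IsDist X s t = IsMinLength X s t (λ _ → ⊤)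

  IsSteinerDist : (Fin k → Subset n) → Subgraph G → Fin n → Fin n → Carrier → Set (ℓ₁ ⊔ ℓ₂)
  IsSteinerDist Rs X s t = IsMinLength X s t (IsGroupSteiner Rs)

module _ {K : OrderedCommutativeRing c ℓ₁ ℓ₂} (G : Graph K n) where
  open OrderedCommutativeRing K

  whole : Subgraph G
  whole = record
    { vertices = ⊤ˢ
    ; edge     = Graph.edge G
    ; edge-sym = Graph.edge-sym G
    ; edge-end = λ _ _ _ → ∈⊤
    ; edge-⊆   = λ _ _ e → e
    }
    where open import Data.Fin.Subset using () renaming (⊤ to ⊤ˢ)
          open import Data.Fin.Subset.Properties using (∈⊤)

  IsConnected : Set
  IsConnected = ∀ u v → Walk whole u v

  -- In a connected G all distances in G are finite, so the inequality
  -- d_X ≤ α d_G forces d_X to be finite as well.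

  IsSubsetwiseSpanner : Carrier → Subset n → Subgraph G → Set (c ⊔ ℓ₁ ⊔ ℓ₂)
  IsSubsetwiseSpanner α S X = ∀ u v → u ∈ S → v ∈ S →
    ∃₂ λ dX dG → IsDist X u v dX × IsDist whole u v dG × dX ≤ α * dG

  IsGroupSteinerSpanner : Carrier → (Fin k → Subset n) → Subgraph G → Set (c ⊔ ℓ₁ ⊔ ℓ₂)
  IsGroupSteinerSpanner β Rs X = IsSpanning X × (∀ s t →
    ∃₂ λ σX σG → IsSteinerDist Rs X s t σX × IsSteinerDist Rs whole s t σG × σX ≤ β * σG)

------------------------------------------------------------------------
-- Machine model: imperative programs over two memories, one of natural
-- numbers and one of weights.  Both are addressed by lists of naturals, e.g.
-- array 7 at index (i , j) is the cell  7 ∷ i ∷ j ∷ [].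
--
-- Every command costs one unit.  Numbers can be added but not multiplied, so
-- T steps lengthen the binary representation of any number by at most O(T)
-- bits: for rational weights, polynomially many steps are polynomial time on a
-- Turing machine.  The only loops are counted ones; as a polynomial time bound
-- can itself serve as the loop counter, this loses no polynomial-time algorithm.

Address : Set
Address = List ℕ

data Exprᴺ : Set where
  lit : ℕ → Exprᴺ
  get : List Exprᴺ → Exprᴺ
  add : Exprᴺ → Exprᴺ → Exprᴺ
  sub : Exprᴺ → Exprᴺ → Exprᴺ

data Exprᵂ : Set where
  zeroᵂ : Exprᵂ
  getᵂ  : List Exprᴺ → Exprᵂ
  addᵂ  : Exprᵂ → Exprᵂ → Exprᵂ

data Test : Set where
  leq  : Exprᴺ → Exprᴺ → Test
  leqᵂ : Exprᵂ → Exprᵂ → Test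
  neg  : Test → Test
  conj : Test → Test → Test

infixr 4 _⨾_
infixr 5 ifᵖ_then_else_ for_below_run_
infix  6 _:=_ _:=ᵂ_

data Program : Set where
  skip            : Program
  _:=_            : List Exprᴺ → Exprᴺ → Program
  _:=ᵂ_           : List Exprᴺ → Exprᵂ → Program
  _⨾_             : Program → Program → Program
  ifᵖ_then_else_  : Test → Program → Program → Program
  -- for x below e run P : evaluate e once, to m; then run P with cell
  -- x ∷ [] set to 0, …, m - 1 in turn.
  for_below_run_  : ℕ → Exprᴺ → Program → Program

module _ (K : OrderedCommutativeRing c ℓ₁ ℓ₂) where
  open OrderedCommutativeRing K

  record Memory : Set c where
    constructor memory
    field
      nats    : Address → ℕ
      weights : Address → Carrier

module _ {K : OrderedCommutativeRing c ℓ₁ ℓ₂} where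
  open OrderedCommutativeRing K
  open Memory

  update : ∀ {a} {A : Set a} → (Address → A) → Address → A → Address → A
  update f x y z = if ⌊ ≡-dec ℕ._≟_ x z ⌋ then y else f z

  mutual
    evalᴺ : Memory K → Exprᴺ → ℕ
    evalᴺ m (lit a)   = a
    evalᴺ m (get es)  = nats m (evalAddress m es)
    evalᴺ m (add a b) = evalᴺ m a ℕ.+ evalᴺ m b
    evalᴺ m (sub a b) = evalᴺ m a ∸ evalᴺ m b

    evalAddress : Memory K → List Exprᴺ → Address
    evalAddress m []       = []
    evalAddress m (e ∷ es) = evalᴺ m e ∷ evalAddress m es

  evalᵂ : Memory K → Exprᵂ → Carrier
  evalᵂ m zeroᵂ      = 0#
  evalᵂ m (getᵂ es)  = weights m (evalAddress m es)
  evalᵂ m (addᵂ a b) = evalᵂ m a + evalᵂ m b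

  evalTest : Memory K → Test → Bool
  evalTest m (leq a b)  = evalᴺ m a ≤ᵇ evalᴺ m b
  evalTest m (leqᵂ a b) = ⌊ evalᵂ m a ≤? evalᵂ m b ⌋
  evalTest m (neg t)    = not (evalTest m t)
  evalTest m (conj t u) = evalTest m t ∧ evalTest m u

  setᴺ : Address → ℕ → Memory K → Memory K
  setᴺ x a m = record m { nats = update (nats m) x a }

  setᵂ : Address → Carrier → Memory K → Memory K
  setᵂ x a m = record m { weights = update (weights m) x a }

  mutual
    exec : Program → Memory K → Memory K
    exec skip                     m = m
    exec (x := e)                 m = setᴺ (evalAddress m x) (evalᴺ m e) m
    exec (x :=ᵂ e)                m = setᵂ (evalAddress m x) (evalᵂ m e) m
    exec (P ⨾ Q)                  m = exec Q (exec P m)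
    exec (ifᵖ t then P else Q)    m = if evalTest m t then exec P m else exec Q m
    exec (for x below e run P)    m = execFor x P (evalᴺ m e) m

    -- the memory after the first j iterations
    execFor : ℕ → Program → ℕ → Memory K → Memory K
    execFor x P zero    m = m
    execFor x P (suc j) m = exec P (setᴺ (x ∷ []) j (execFor x P j m))

  mutual
    cost : Program → Memory K → ℕ
    cost skip                     m = 1
    cost (x := e)                 m = 1
    cost (x :=ᵂ e)                m = 1
    cost (P ⨾ Q)                  m = cost P m ℕ.+ cost Q (exec P m)
    cost (ifᵖ t then P else Q)    m = 1 ℕ.+ (if evalTest m t then cost P m else cost Q m)
    cost (for x below e run P)    m = 1 ℕ.+ costFor x P (evalᴺ m e) m

    costFor : ℕ → Program → ℕ → Memory K → ℕ
    costFor x P zero    m = 0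
    costFor x P (suc j) m =
      costFor x P j m ℕ.+ (1 ℕ.+ cost P (setᴺ (x ∷ []) j (execFor x P j m)))

------------------------------------------------------------------------
-- Input and output conventions

bit : Bool → ℕ
bit true  = 1
bit false = 0

-- f at index i, or the default d when i is out of range
at : ∀ {a} {A : Set a} → (Fin n → A) → A → ℕ → A
at {n} f d i with i ℕ.<? n
... | yes i<n = f (fromℕ< i<n)
... | no  _   = d

module _ {K : OrderedCommutativeRing c ℓ₁ ℓ₂} {G : Graph K n} where
  open OrderedCommutativeRing K using (0#)

  -- The initial memory: n, k, the adjacency matrix and weights of G, the sets
  -- R_i, and the vertices and edges of the H_i; zero elsewhere.
  input : (Fin k → Subset n) → (Fin k → Subgraph G) → Memory K
  input {k} Rs Hs = memory ns ws
    where
    ns : Address → ℕ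
    ns (0 ∷ [])             = n
    ns (1 ∷ [])             = k
    ns (2 ∷ u ∷ v ∷ [])     = at (λ u → at (λ v → bit (Graph.edge G u v)) 0 v) 0 u
    ns (3 ∷ i ∷ v ∷ [])     = at (λ i → at (λ v → bit (lookup (Rs i) v)) 0 v) 0 i
    ns (4 ∷ i ∷ v ∷ [])     = at (λ i → at (λ v → bit (lookup (Subgraph.vertices (Hs i)) v)) 0 v) 0 i
    ns (5 ∷ i ∷ u ∷ v ∷ []) =
      at (λ i → at (λ u → at (λ v → bit (Subgraph.edge (Hs i) u v)) 0 v) 0 u) 0 i
    ns _                    = 0

    ws : Address → OrderedCommutativeRing.Carrier K
    ws (0 ∷ u ∷ v ∷ []) = at (λ u → at (λ v → Graph.weight G u v) 0# v) 0# u
    ws _                = 0#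

  -- A spanning subgraph is output as its adjacency matrix, in array 6.
  Outputs : Memory K → Subgraph G → Set
  Outputs m X = IsSpanning X ×
    (∀ u v → Memory.nats m (6 ∷ toℕ u ∷ toℕ v ∷ []) ≡ bit (Subgraph.edge X u v))

{-# OPTIONS --safe #-}
module Submission where

-- The output H is the union of the H_i and, for each i, a forest of shortest
-- paths of G to R_i, which Dijkstra's algorithm grows in at most n edges.
-- A walk in G between s and a ∈ R_i is replaced in H by the forest path from s
-- to its root r ∈ R_i, no longer than the walk, followed by a walk from r to a
-- in H_i, at most 2α times as long as it.  Cutting an optimal group Steiner
-- path of G at all vertices of ⋃ R_i and replacing every piece yields the
-- stretch 2α + 1.

open import Level using (Level; _⊔_)
open import Data.Bool using (Bool; true; false; T; _∧_; not; if_then_else_)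
open import Data.Bool.ListAction using (any)
open import Data.Bool.Properties using (T?; T-∧; T-≡)
import Data.Bool.Properties as Bool
open import Data.Empty using (⊥-elim)
open import Data.Fin using (Fin; toℕ; fromℕ<)
import Data.Fin.Properties as Fin
open import Data.Fin.Subset using (Subset; _∈_; _∉_; _─_; inside; outside; Nonempty)
import Data.Fin.Subset as Subset
open import Data.Fin.Subset.Properties using (_∈?_; ∈⊤; _⊆?_; x∈p∧x∉q⇒x∈p─q; p─q⊆p)
open import Data.List using (List; []; _∷_; _++_; map; length; allFin; cartesianProduct)
open import Data.List.Properties using (≡-dec; ∷-injectiveˡ; ∷-injectiveʳ; length-tabulate)
import Data.List.Membership.Propositional as List
open import Data.List.Membership.Propositional.Properties
  using (∈-cartesianProduct⁺; ∈-++⁺ˡ; ∈-++⁺ʳ; ∈-map⁺; ∈-allFin; ∈-filter⁺; ∈-filter⁻)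
import Data.List.Relation.Unary.All as All
open import Data.List.Relation.Unary.AllPairs using ([]; _∷_)
open import Data.List.Relation.Unary.Any using (here; there)
open import Data.List.Relation.Unary.Any.Properties using (any⁺)
open import Data.List.Relation.Unary.Unique.Propositional using (Unique)
import Data.List.Relation.Unary.Unique.Propositional.Properties as Unique
open import Data.Nat as ℕ using (ℕ; zero; suc; _<ᵇ_; _≤ᵇ_; _^_; _∸_; NonZero; z≤n; s≤s)
import Data.Nat.Properties as ℕ
open import Data.Product using (Σ-syntax; ∃₂; ∃-syntax; _×_; _,_; proj₁; proj₂)
import Data.Product.Properties as Product
open import Data.Sum using (_⊎_; inj₁; inj₂; [_,_]′)
open import Data.Unit using (tt)
open import Data.Vec using ([]; _∷_; tabulate)
import Data.Vec as Vec
import Data.Vec.Properties as Vec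
open import Function using (_∘_; id)
open import Function.Bundles using (Equivalence)
open import Relation.Binary.Bundles using (Poset)
open import Relation.Binary.Definitions using (DecidableEquality)
open import Relation.Binary.PropositionalEquality as ≡ using (_≡_; _≢_)
import Relation.Binary.Reasoning.PartialOrder as PosetReasoning
open import Relation.Binary.Structures using (IsDecTotalOrder)
open import Relation.Nullary using (¬_; Dec; yes; no)
open import Relation.Nullary.Decidable using (_×-dec_; ¬?; ⌊_⌋; toWitness; fromWitness)
open import Defs

-- Stretch compares least lengths, so these must be shown to exist: there are infinitely many walks,
-- and an ordered ring need not be well-ordered. Dijkstra's algorithm is therefore treated
-- abstractly, over any type of vertices, through the invariant `Settled`. It is instantiated twice:
-- on `G`, where the program runs it to build the forests, and on an exponentially large product
-- graph, where it only proves that a least group Steiner length is attained and costs no running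
-- time. Replacing a piece of a walk requires a terminal at just one of its ends. Hence the first
-- piece, which leads to the first terminal, and the last, which leaves the last one, are treated
-- like the others, and every terminal on the old walk remains on the new one. The factor 2 in the
-- edge bound arises because each new forest edge is listed in both orientations.

remove : ∀ {a} {A : Set a} {v : A} {xs} → v List.∈ xs →
         ∃[ ys ] length xs ≡ suc (length ys) × (∀ {x} → x List.∈ xs → x ≡ v ⊎ x List.∈ ys)
remove {xs = _ ∷ xs} (here ≡.refl) = xs , ≡.refl , λ where
  (here eq) → inj₁ eq
  (there i) → inj₂ i
remove {xs = x ∷ _} (there v∈xs) with remove v∈xs
... | ys , eq , rest = x ∷ ys , ≡.cong suc eq , λ where
  (here eq) → inj₂ (here eq)
  (there i) → [ inj₁ , inj₂ ∘ there ]′ (rest i)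

-- Induction on `xs`, removing from `ys` one occurrence of each element met. Uniqueness guarantees
-- that the later elements of `xs` survive the removal.
unique-length-≤ : ∀ {a} {A : Set a} {xs ys : List A} → Unique xs →
                  (∀ {x} → x List.∈ xs → x List.∈ ys) → length xs ℕ.≤ length ys
unique-length-≤ {xs = []} [] _ = z≤n
unique-length-≤ {xs = x ∷ xs} (x∉xs ∷ uniq) xs⊆ys with remove (xs⊆ys (here ≡.refl))
... | zs , eq , rest rewrite eq = s≤s (unique-length-≤ uniq λ {y} y∈xs →
  [ (λ y≡x → ⊥-elim (All.lookup x∉xs y∈xs (≡.sym y≡x))) , id ]′ (rest (xs⊆ys (there y∈xs))))

-- Ordered commutative rings

module OrderedRing {c ℓ₁ ℓ₂ : Level} (K : OrderedCommutativeRing c ℓ₁ ℓ₂) where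
  open OrderedCommutativeRing K
  open IsDecTotalOrder isDecTotalOrder public
    using (total; ≤-respˡ-≈; ≤-respʳ-≈)
    renaming (refl to ≤-refl; reflexive to ≤-reflexive; trans to ≤-trans)
  open import Algebra.Properties.Ring ring using (-‿distribˡ-*; -‿involutive)

  poset : Poset c ℓ₁ ℓ₂
  poset = record { isPartialOrder = IsDecTotalOrder.isPartialOrder isDecTotalOrder }

  module ≤-Reasoning = PosetReasoning poset

  +-monoˡ-≤ : ∀ z {x y} → x ≤ y → x + z ≤ y + z
  +-monoˡ-≤ z x≤y = ≤-respˡ-≈ (+-comm z _) (≤-respʳ-≈ (+-comm z _) (+-monoʳ-≤ z x≤y))

  +-mono-≤ : ∀ {x y u v} → x ≤ y → u ≤ v → x + u ≤ y + v
  +-mono-≤ x≤y u≤v = ≤-trans (+-monoˡ-≤ _ x≤y) (+-monoʳ-≤ _ u≤v)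

  x≤y+x : ∀ {x y} → 0# ≤ y → x ≤ y + x
  x≤y+x 0≤y = ≤-respˡ-≈ (+-identityˡ _) (+-monoˡ-≤ _ 0≤y)

  +-nonNegative : ∀ {x y} → 0# ≤ x → 0# ≤ y → 0# ≤ x + y
  +-nonNegative 0≤x 0≤y = ≤-trans 0≤y (x≤y+x 0≤x)

  0≤-x : ∀ {x} → x ≤ 0# → 0# ≤ - x
  0≤-x {x} x≤0 = ≤-respˡ-≈ (-‿inverseˡ x) (≤-respʳ-≈ (+-identityʳ (- x)) (+-monoʳ-≤ (- x) x≤0))

  -- By totality: if `1# ≤ 0#`, then `- 1#` is non-negative, and so is its square, which equals
  -- `1#`.
  0≤1 : 0# ≤ 1#
  0≤1 with total 0# 1#
  ... | inj₁ 0≤1 = 0≤1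
  ... | inj₂ 1≤0 = ≤-respʳ-≈ -1*-1≈1 (*-nonNegative (0≤-x 1≤0) (0≤-x 1≤0))
    where
    -1*-1≈1 : - 1# * - 1# ≈ 1#
    -1*-1≈1 = trans (sym (-‿distribˡ-* 1# (- 1#)))
                (trans (-‿cong (*-identityˡ (- 1#))) (-‿involutive 1#))

  *-monoʳ-≤ : ∀ {z x y} → 0# ≤ z → x ≤ y → z * x ≤ z * y
  *-monoʳ-≤ {z} {x} {y} 0≤z x≤y = begin
    z * x                  ≤⟨ x≤y+x (*-nonNegative 0≤z 0≤y-x) ⟩
    z * (y + - x) + z * x  ≈⟨ distribˡ z (y + - x) x ⟨
    z * (y + - x + x)      ≈⟨ *-congˡ (+-assoc y (- x) x) ⟩
    z * (y + (- x + x))    ≈⟨ *-congˡ (+-congˡ (-‿inverseˡ x)) ⟩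
    z * (y + 0#)           ≈⟨ *-congˡ (+-identityʳ y) ⟩
    z * y                  ∎
    where
    open ≤-Reasoning
    0≤y-x : 0# ≤ y + - x
    0≤y-x = ≤-respˡ-≈ (-‿inverseʳ x) (+-monoˡ-≤ (- x) x≤y)

  module _ {B : Set} {P : B → Set} (P? : ∀ b → Dec (P b)) (f : B → Carrier) where

    argmin : ∀ bs → (∀ {b} → b List.∈ bs → ¬ P b) ⊎
                    (∃[ b ] P b × (∀ {b'} → b' List.∈ bs → P b' → f b ≤ f b'))
    argmin [] = inj₁ λ ()
    argmin (b ∷ bs) with P? b | argmin bs
    ... | no ¬p | inj₁ none = inj₁ λ where
      (here ≡.refl) → ¬p
      (there i)     → none i
    ... | no ¬p | inj₂ (a , pa , min) = inj₂ (a , pa , λ where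
      (here ≡.refl) p → ⊥-elim (¬p p)
      (there i)     p → min i p)
    ... | yes p | inj₁ none = inj₂ (b , p , λ where
      (here ≡.refl) _ → ≤-refl
      (there i)     q → ⊥-elim (none i q))
    ... | yes p | inj₂ (a , pa , min) with total (f a) (f b)
    ...   | inj₁ fa≤fb = inj₂ (a , pa , λ where
      (here ≡.refl) _ → fa≤fb
      (there i)     q → min i q)
    ...   | inj₂ fb≤fa = inj₂ (b , p , λ where
      (here ≡.refl) _ → ≤-refl
      (there i)     q → ≤-trans fb≤fa (min i q))

-- Dijkstra's algorithm

module Dijkstra {c ℓ₁ ℓ₂ : Level} (K : OrderedCommutativeRing c ℓ₁ ℓ₂)
  {A : Set} (w : A → A → OrderedCommutativeRing.Carrier K) (Target : A → Set) where
  open OrderedCommutativeRing K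
  open OrderedRing K

  data Reach (E : A → A → Set) : A → Carrier → Set c where
    root   : ∀ {v} → Target v → Reach E v 0#
    extend : ∀ {u v d} → E u v → Reach E v d → Reach E u (w u v + d)

  reach-mono : ∀ {E F : A → A → Set} → (∀ {u v} → E u v → F u v) → ∀ {v d} → Reach E v d → Reach F v d
  reach-mono E⊆F (root t)     = root t
  reach-mono E⊆F (extend e r) = extend (E⊆F e) (reach-mono E⊆F r)

  module _ {E : A → A → Set} (w-nonNeg : ∀ {u v} → E u v → 0# ≤ w u v) where

    reach-nonNeg : ∀ {v d} → Reach E v d → 0# ≤ d
    reach-nonNeg (root _)     = ≤-refl
    reach-nonNeg (extend e r) = +-nonNegative (w-nonNeg e) (reach-nonNeg r)

    Crossing : (A → Bool) → A → A → Set
    Crossing S x y = ¬ T (S x) × T (S y) × E x y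

    -- After S is settled with (final) distances D, at most r vertices remain;
    -- F is the tree grown so far.
    record Settled (F : A → A → Set) (S : A → Bool) (D : A → Carrier) (r : ℕ) : Set (c ⊔ ℓ₂) where
      field
        reachable   : ∀ {x} → T (S x) → ∃[ d ] Reach F x d × d ≤ D x
        lower-bound : ∀ {x d} → T (S x) → Reach E x d → D x ≤ d
        target      : ∀ {x} → Target x → T (S x)
        unsettled   : List A
        covered     : ∀ x → T (S x) ⊎ x List.∈ unsettled
        remaining   : length unsettled ℕ.≤ r

    module _ {F : A → A → Set} {S : A → Bool} {D : A → Carrier} {r : ℕ} (I : Settled F S D r) where
      open Settled I

      -- Take the first edge by which the walk enters `S`. The walk from there on is controlled by
      -- `lower-bound`, and the part before that edge is dropped because weights are non-negative.
      crossing : ∀ {v d} → Reach E v d → ¬ T (S v) → ∃₂ λ x y → Crossing S x y × w x y + D y ≤ d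
      crossing (root t) v∉S = ⊥-elim (v∉S (target t))
      crossing (extend {u} {v} e r) u∉S with T? (S v)
      ... | yes v∈S = u , v , (u∉S , v∈S , e) , +-monoʳ-≤ _ (lower-bound v∈S r)
      ... | no  v∉S with crossing r v∉S
      ...   | x , y , xy , ≤d = x , y , xy , ≤-trans ≤d (x≤y+x (w-nonNeg e))

      all-settled : (∀ x y → ¬ Crossing S x y) → ∀ {v d} → Reach E v d → T (S v)
      all-settled none {v} r with T? (S v)
      ... | yes v∈S = v∈S
      ... | no  v∉S with crossing r v∉S
      ...   | x , y , xy , _ = ⊥-elim (none x y xy)

      -- The distance of `x` becomes final because every walk from `x` to a target crosses into `S`
      -- somewhere, and no crossing edge has a smaller key than `(x , y)`. The new `F'`, `S'` and
      -- `D'` are constrained pointwise only, so that the lemma applies both to functions built by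
      -- `if` and to the contents of a memory.
      settle : ∀ {F' S' D' r' x y} → r ≡ suc r' → Crossing S x y →
               (∀ x' y' → Crossing S x' y' → w x y + D y ≤ w x' y' + D y') →
               (∀ {u v} → F u v → F' u v) → F' x y →
               T (S' x) → D' x ≈ w x y + D y →
               (∀ v → v ≢ x → S' v ≡ S v × D' v ≡ D v) →
               DecidableEquality A → Settled F' S' D' r'
      settle {F'} {S'} {D'} {r'} {x} {y} ≡.refl (x∉S , y∈S , xy) min F⊆F' xyF' x∈S' D'x same _≟_ = record
        { reachable   = reachable′
        ; lower-bound = lower-bound′
        ; target      = λ {v} t → S⊆S' (target t)
        ; unsettled   = proj₁ removed
        ; covered     = covered′
        ; remaining   = ℕ.≤-pred (≡.subst (ℕ._≤ suc r') (proj₁ (proj₂ removed)) remaining)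
        }
        where
        x∈unsettled : x List.∈ unsettled
        x∈unsettled = [ ⊥-elim ∘ x∉S , id ]′ (covered x)

        removed : ∃[ ys ] length unsettled ≡ suc (length ys) ×
                          (∀ {v} → v List.∈ unsettled → v ≡ x ⊎ v List.∈ ys)
        removed = remove x∈unsettled

        S⊆S' : ∀ {v} → T (S v) → T (S' v)
        S⊆S' {v} v∈S with v ≟ x
        ... | yes ≡.refl = x∈S'
        ... | no  v≢x    = ≡.subst T (≡.sym (proj₁ (same v v≢x))) v∈S

        covered′ : ∀ v → T (S' v) ⊎ v List.∈ proj₁ removed
        covered′ v with covered v
        ... | inj₁ v∈S = inj₁ (S⊆S' v∈S)
        ... | inj₂ i with proj₂ (proj₂ removed) i
        ...   | inj₁ ≡.refl = inj₁ x∈S'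
        ...   | inj₂ j      = inj₂ j

        reachable′ : ∀ {v} → T (S' v) → ∃[ d ] Reach F' v d × d ≤ D' v
        reachable′ {v} v∈S' with v ≟ x
        ... | yes ≡.refl with reachable y∈S
        ...   | d , r , d≤ = w x y + d , extend xyF' (reach-mono F⊆F' r) ,
                             ≤-respʳ-≈ (sym D'x) (+-monoʳ-≤ _ d≤)
        reachable′ {v} v∈S' | no v≢x with same v v≢x
        ... | S≡ , D≡ with reachable (≡.subst T S≡ v∈S')
        ...   | d , r , d≤ = d , reach-mono F⊆F' r , ≡.subst (d ≤_) (≡.sym D≡) d≤

        lower-bound′ : ∀ {v d} → T (S' v) → Reach E v d → D' v ≤ d
        lower-bound′ {v} v∈S' r with v ≟ x
        ... | yes ≡.refl with crossing r x∉S
        ...   | x' , y' , c , ≤d = ≤-respˡ-≈ (sym D'x) (≤-trans (min x' y' c) ≤d)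
        lower-bound′ {v} {d} v∈S' r | no v≢x with same v v≢x
        ... | S≡ , D≡ = ≡.subst (_≤ d) (≡.sym D≡) (lower-bound (≡.subst T S≡ v∈S') r)

    initially-settled : ∀ {F : A → A → Set} {S : A → Bool} {D : A → Carrier} {vs r} →
                        (∀ {x} → T (S x) → Target x) → (∀ {x} → Target x → T (S x)) →
                        (∀ x → D x ≡ 0#) → (∀ x → x List.∈ vs) → length vs ℕ.≤ r → Settled F S D r
    initially-settled {D = D} {vs} S⊆ ⊆S D≡0 complete ≤r = record
      { reachable   = λ {x} s → 0# , root (S⊆ s) , ≤-reflexive (reflexive (≡.sym (D≡0 x)))
      ; lower-bound = λ {x} _ r → ≡.subst (_≤ _) (≡.sym (D≡0 x)) (reach-nonNeg r)
      ; target      = ⊆S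
      ; unsettled   = vs
      -- `unsettled` may list settled vertices as well, so the full list of vertices serves at the
      -- start.
      ; covered     = λ x → inj₂ (complete x)
      ; remaining   = ≤r
      }

    -- A counted loop keeps running after the search is over. With an empty list of unsettled
    -- vertices the invariant holds for any `r'`.
    fully-settled : ∀ {F F' : A → A → Set} {S S' : A → Bool} {D D' : A → Carrier} {r r'} → Settled F S D r →
                    (∀ {u v} → F u v → F' u v) →
                    (∀ x → S' x ≡ S x) → (∀ x → D' x ≡ D x) → (∀ x → T (S x)) → Settled F' S' D' r'
    fully-settled I F⊆F' S≡ D≡ all = record
      { reachable   = λ {x} _ → let d , r , d≤ = reachable (all x) in
                                d , reach-mono F⊆F' r , ≡.subst (d ≤_) (≡.sym (D≡ x)) d≤
      ; lower-bound = λ {x} {d} _ r → ≡.subst (_≤ d) (≡.sym (D≡ x)) (lower-bound (all x) r)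
      ; target      = λ {x} _ → ≡.subst T (≡.sym (S≡ x)) (all x)
      ; unsettled   = []
      ; covered     = λ x → inj₁ (≡.subst T (≡.sym (S≡ x)) (all x))
      ; remaining   = z≤n
      }
      where open Settled I

    none-remaining : ∀ {F : A → A → Set} {S : A → Bool} {D : A → Carrier} → Settled F S D 0 → ∀ x → T (S x)
    none-remaining I x with Settled.unsettled I | Settled.covered I x | Settled.remaining I
    ... | []    | inj₁ s | _ = s
    ... | _ ∷ _ | _      | ()

    module _ (_≟_ : DecidableEquality A) (E? : ∀ u v → Dec (E u v)) (target? : ∀ v → Dec (Target v))
             (vs : List A) (complete : ∀ v → v List.∈ vs) where

      -- There may be vertices from which no target can be reached, so the search ends when no
      -- crossing edge is left rather than when everything is settled.
      saturate : ∀ r {S D} → Settled E S D r →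
                 ∃[ S' ] ∃[ D' ] ∃[ r' ] Settled E S' D' r' × (∀ x y → ¬ Crossing S' x y)
      saturate zero {S} {D} I = S , D , 0 , I , λ x y (x∉S , _) → x∉S (none-remaining I x)
      saturate (suc r) {S} {D} I
        with argmin (λ (x , y) → ¬? (T? (S x)) ×-dec T? (S y) ×-dec E? x y)
                    (λ (x , y) → w x y + D y) (cartesianProduct vs vs)
      ... | inj₁ none = S , D , suc r , I , λ x y → none (∈-cartesianProduct⁺ (complete x) (complete y))
      ... | inj₂ ((x , y) , xy , min) =
        saturate r (settle I {S' = S'} {D' = D'} ≡.refl xy
          (λ x' y' → min (∈-cartesianProduct⁺ (complete x') (complete y'))) id (proj₂ (proj₂ xy))
          S'x (reflexive D'x) same _≟_)
        where
        S' : A → Bool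
        S' v = if ⌊ v ≟ x ⌋ then true else S v
        D' : A → Carrier
        D' v = if ⌊ v ≟ x ⌋ then w x y + D y else D v
        S'x : T (S' x)
        S'x with x ≟ x
        ... | yes _   = _
        ... | no  x≢x = ⊥-elim (x≢x ≡.refl)
        D'x : D' x ≡ w x y + D y
        D'x with x ≟ x
        ... | yes _   = ≡.refl
        ... | no  x≢x = ⊥-elim (x≢x ≡.refl)
        same : ∀ v → v ≢ x → S' v ≡ S v × D' v ≡ D v
        same v v≢x with v ≟ x
        ... | yes v≡x = ⊥-elim (v≢x v≡x)
        ... | no  _   = ≡.refl , ≡.refl

      shortest : ∀ {v d} → Reach E v d → ∃[ d ] Reach E v d × (∀ {d'} → Reach E v d' → d ≤ d')
      shortest r with saturate (length vs)
                        (initially-settled {S = λ x → ⌊ target? x ⌋} {D = λ _ → 0#}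
                          toWitness fromWitness (λ _ → ≡.refl) complete ℕ.≤-refl)
      ... | S , D , _ , I , none with all-settled I none r
      ...   | v∈S with Settled.reachable I v∈S
      ...     | d , r' , d≤ = d , r' , λ r″ → ≤-trans d≤ (Settled.lower-bound I v∈S r″)

-- Walks

module Walks {c ℓ₁ ℓ₂ : Level} (K : OrderedCommutativeRing c ℓ₁ ℓ₂) {n : ℕ} (G : Graph K n) where
  open OrderedCommutativeRing K
  open OrderedRing K
  open Graph G using (weight; weight-sym)
  open Subgraph

  infixr 5 _++ʷ_

  _++ʷ_ : ∀ {X : Subgraph G} {s u t} → Walk X s u → Walk X u t → Walk X s t
  stop _   ++ʷ q = q
  step e p ++ʷ q = step e (p ++ʷ q)

  ++-length : ∀ {X : Subgraph G} {s u t} (p : Walk X s u) (q : Walk X u t) →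
              walkLength (p ++ʷ q) ≈ walkLength p + walkLength q
  ++-length (stop _)   q = sym (+-identityˡ _)
  ++-length (step e p) q = trans (+-congˡ (++-length p q)) (sym (+-assoc _ _ _))

  visits-start : ∀ {X : Subgraph G} {s t} (p : Walk X s t) → Visits s p
  visits-start (stop _)   = at-stop
  visits-start (step _ _) = at-step

  visits-end : ∀ {X : Subgraph G} {s t} (p : Walk X s t) → Visits t p
  visits-end (stop _)   = at-stop
  visits-end (step _ p) = later (visits-end p)

  visits-++ˡ : ∀ {X : Subgraph G} {x s u t} {p : Walk X s u} (q : Walk X u t) → Visits x p → Visits x (p ++ʷ q)
  visits-++ˡ q at-stop   = visits-start q
  visits-++ˡ q at-step   = at-step
  visits-++ˡ q (later v) = later (visits-++ˡ q v)

  visits-++ʳ : ∀ {X : Subgraph G} {x s u t} (p : Walk X s u) {q : Walk X u t} → Visits x q → Visits x (p ++ʷ q)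
  visits-++ʳ (stop _)   v = v
  visits-++ʳ (step _ p) v = later (visits-++ʳ p v)

  edge-walk : ∀ {X : Subgraph G} {u v} → T (edge X u v) → Walk X u v
  edge-walk {X} {u} {v} e = step e (stop (edge-end X v u (≡.subst T (edge-sym X u v) e)))

  reverse : ∀ {X : Subgraph G} {s t} → Walk X s t → Walk X t s
  reverse (stop s∈X) = stop s∈X
  reverse {X} (step {u} {v} e p) = reverse p ++ʷ edge-walk (≡.subst T (edge-sym X u v) e)

  reverse-length : ∀ {X : Subgraph G} {s t} (p : Walk X s t) → walkLength (reverse p) ≈ walkLength p
  reverse-length (stop _) = refl
  reverse-length {X} (step {u} {v} e p) = begin-equality
    walkLength (reverse p ++ʷ edge-walk e′)  ≈⟨ ++-length (reverse p) (edge-walk e′) ⟩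
    walkLength (reverse p) + (weight v u + 0#) ≈⟨ +-cong (reverse-length p) (+-identityʳ _) ⟩
    walkLength p + weight v u                ≈⟨ +-comm _ _ ⟩
    weight v u + walkLength p                ≈⟨ +-congʳ (weight-sym v u (edge-⊆ X v u e′)) ⟩
    weight u v + walkLength p                ∎
    where
    open ≤-Reasoning
    e′ : T (edge X v u)
    e′ = ≡.subst T (edge-sym X u v) e

  -- Lengths are preserved exactly because the edges of every subgraph carry the weights of `G`.
  embed : ∀ {X Y : Subgraph G} → (∀ v → v ∈ vertices X → v ∈ vertices Y) →
          (∀ u v → T (edge X u v) → T (edge Y u v)) →
          ∀ {s t} (p : Walk X s t) → ∃[ q ] walkLength {X = Y} {s} {t} q ≡ walkLength p
  embed V⊆ E⊆ (stop s∈X) = stop (V⊆ _ s∈X) , ≡.refl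
  embed V⊆ E⊆ (step e p) with embed V⊆ E⊆ p
  ... | q , eq = step (E⊆ _ _ e) q , ≡.cong (_ +_) eq

  module _ {R : Subset n} where
    open Dijkstra K weight (_∈ R)

    reach⇒walk : ∀ (X : Subgraph G) → IsSpanning X → ∀ {v d} → Reach (λ u v → T (edge X u v)) v d →
                 ∃[ r ] r ∈ R × Σ[ p ∈ Walk X v r ] walkLength p ≡ d
    reach⇒walk X span (root v∈R) = _ , v∈R , stop (span _) , ≡.refl
    reach⇒walk X span (extend e r) with reach⇒walk X span r
    ... | r , r∈R , p , eq = r , r∈R , step e p , ≡.cong (_ +_) eq

    walk⇒reach : ∀ (X : Subgraph G) {v r} (p : Walk X v r) → r ∈ R →
                 Reach (λ u v → T (edge X u v)) v (walkLength p)
    walk⇒reach X (stop _)   r∈R = root r∈R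
    walk⇒reach X (step e p) r∈R = extend e (walk⇒reach X p r∈R)

  -- A condition on distances alone; the number of forest edges is tracked separately, through
  -- `Covered`.
  ContainsForest : (Fin n → Fin n → Bool) → Subset n → Set (c ⊔ ℓ₂)
  ContainsForest H R = ∀ v → ∃[ d ] Reach (λ u v → T (H u v)) v d ×
                       (∀ {d'} → Reach (λ u v → T (Graph.edge G u v)) v d' → d ≤ d')
    where open Dijkstra K weight (_∈ R)

allSubsets : ∀ k → List (Subset k)
allSubsets zero    = [] ∷ []
allSubsets (suc k) = map (inside ∷_) (allSubsets k) ++ map (outside ∷_) (allSubsets k)

∈-allSubsets : ∀ {k} (S : Subset k) → S List.∈ allSubsets k
∈-allSubsets []            = here ≡.refl
∈-allSubsets (true ∷ S)  = ∈-++⁺ˡ (∈-map⁺ (inside ∷_) (∈-allSubsets S))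
∈-allSubsets (false ∷ S) = ∈-++⁺ʳ (map (inside ∷_) (allSubsets _)) (∈-map⁺ (outside ∷_) (∈-allSubsets S))

x∈p─q⇒x∉q : ∀ {k} {x : Fin k} (p q : Subset k) → x ∈ p ─ q → x ∉ q
x∈p─q⇒x∉q (_ ∷ p) (inside  ∷ q) (Vec.there x∈) (Vec.there x∈q) = x∈p─q⇒x∉q p q x∈ x∈q
x∈p─q⇒x∉q (_ ∷ p) (outside ∷ q) (Vec.there x∈) (Vec.there x∈q) = x∈p─q⇒x∉q p q x∈ x∈q

-- Group Steiner walks are walks in the product of the graph with the lattice of
-- sets of groups, so a shortest one is found by Dijkstra's algorithm there.

module GroupSteiner {c ℓ₁ ℓ₂ : Level} (K : OrderedCommutativeRing c ℓ₁ ℓ₂) {n k : ℕ} (G : Graph K n)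
  (Rs : Fin k → Subset n) where
  open OrderedCommutativeRing K
  open Graph G using (weight; weight-nonNeg)
  open Subgraph

  groups : Fin n → Subset k
  groups u = tabulate (λ i → Vec.lookup (Rs i) u)

  ∈-groups⁺ : ∀ {i u} → u ∈ Rs i → i ∈ groups u
  ∈-groups⁺ {i} {u} u∈ = Vec.lookup⇒[]= i (groups u)
    (≡.trans (Vec.lookup∘tabulate (λ i → Vec.lookup (Rs i) u) i) (Vec.[]=⇒lookup u∈))

  ∈-groups⁻ : ∀ {i u} → i ∈ groups u → u ∈ Rs i
  ∈-groups⁻ {i} {u} i∈ = Vec.lookup⇒[]= u (Rs i)
    (≡.trans (≡.sym (Vec.lookup∘tabulate (λ i → Vec.lookup (Rs i) u) i)) (Vec.[]=⇒lookup i∈))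

  module _ (X : Subgraph G) (span : IsSpanning X) (t : Fin n) where

    -- The second component of a state is the set of groups still to be visited.
    State : Set
    State = Fin n × Subset k

    -- The groups of a vertex are struck off when it is left. Those of the last vertex are therefore
    -- tested in `Target`.
    Edge : State → State → Set
    Edge (u , S) (v , S') = T (edge X u v) × S' ≡ S ─ groups u

    Target : State → Set
    Target (u , S) = u ≡ t × S Subset.⊆ groups u

    open Dijkstra K {State} (λ (u , _) (v , _) → weight u v) Target

    Covers : ∀ {s} → Subset k → Walk X s t → Set
    Covers S p = ∀ {i} → i ∈ S → ∃[ v ] v ∈ Rs i × Visits v p

    covers⇒reach : ∀ {s S} (p : Walk X s t) → Covers S p → Reach Edge (s , S) (walkLength p)
    covers⇒reach {S = S} (stop _) cov = root (≡.refl , at-target)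
      where
      at-target : S Subset.⊆ groups t
      at-target i∈S with cov i∈S
      ... | _ , v∈R , at-stop = ∈-groups⁺ v∈R
    covers⇒reach {s} {S} (step e p) cov = extend (e , ≡.refl) (covers⇒reach p rest)
      where
      rest : Covers (S ─ groups s) p
      rest i∈ with cov (p─q⊆p S (groups s) i∈)
      ... | _ , v∈R , at-step = ⊥-elim (x∈p─q⇒x∉q S (groups s) i∈ (∈-groups⁺ v∈R))
      ... | v , v∈R , later vis = v , v∈R , vis

    reach⇒covers : ∀ {s S d} → Reach Edge (s , S) d → Σ[ p ∈ Walk X s t ] Covers S p × walkLength p ≡ d
    reach⇒covers (root (≡.refl , S⊆)) = stop (span _) , (λ i∈S → _ , ∈-groups⁻ (S⊆ i∈S) , at-stop) , ≡.refl
    reach⇒covers {s} {S} (extend (e , ≡.refl) r) with reach⇒covers r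
    ... | p , cov , eq = step e p , cov′ , ≡.cong (_ +_) eq
      where
      cov′ : Covers S (step e p)
      cov′ {i} i∈S with i ∈? groups s
      ... | yes i∈ = s , ∈-groups⁻ i∈ , at-step
      ... | no  i∉ with cov (x∈p∧x∉q⇒x∈p─q i∈S i∉)
      ...   | v , v∈R , vis = v , v∈R , later vis

    -- The given walk makes a target reachable, and finiteness of the state space makes a least
    -- length attained. The enumeration of all sets of groups belongs to this existence proof; the
    -- program never forms it.
    steinerDist : ∀ {s} (p : Walk X s t) → IsGroupSteiner Rs p → ∃[ d ] IsSteinerDist Rs X s t d
    steinerDist p steiner
      with shortest (λ {(u , _)} {(v , _)} (e , _) → weight-nonNeg u v (edge-⊆ X u v e))
             (Product.≡-dec Fin._≟_ (Vec.≡-dec Bool._≟_))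
             (λ (u , S) (v , S') → T? (edge X u v) ×-dec Vec.≡-dec Bool._≟_ S' (S ─ groups u))
             (λ (u , S) → (u Fin.≟ t) ×-dec (S ⊆? groups u))
             (cartesianProduct (allFin n) (allSubsets k))
             (λ (u , S) → ∈-cartesianProduct⁺ (∈-allFin u) (∈-allSubsets S))
             (covers⇒reach {S = Subset.⊤} p (λ {i} _ → steiner i))
    ... | d , r , min with reach⇒covers r
    ...   | q , cov , eq = d , (q , (λ i → cov ∈⊤) , reflexive eq) ,
                           λ p' steiner' → min (covers⇒reach p' λ {i} _ → steiner' i)

-- The stretch bound

module Spanner {c ℓ₁ ℓ₂ : Level} (K : OrderedCommutativeRing c ℓ₁ ℓ₂) {n k : ℕ} (G : Graph K n)
  (connected : IsConnected G) (Rs : Fin k → Subset n) (Rs-nonempty : ∀ i → Nonempty (Rs i))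
  (α : OrderedCommutativeRing.Carrier K)
  (1≤α : OrderedCommutativeRing._≤_ K (OrderedCommutativeRing.1# K) α)
  (Hs : Fin k → Subgraph G) (spanners : ∀ i → IsSubsetwiseSpanner G α (Rs i) (Hs i)) where
  open OrderedCommutativeRing K
  open OrderedRing K
  open Graph G using (weight)
  open Subgraph
  open Walks K G
  open GroupSteiner K G Rs

  β : Carrier
  β = (1# + 1#) * α + 1#

  0≤α : 0# ≤ α
  0≤α = ≤-trans 0≤1 1≤α

  -- The two summands bound the two parts of a detour: `α * (x + x)` in the spanner and `x` in the
  -- forest.
  β-* : ∀ x → β * x ≈ α * (x + x) + x
  β-* x = begin-equality
    β * x                             ≈⟨ distribʳ x ((1# + 1#) * α) 1# ⟩
    (1# + 1#) * α * x + 1# * x        ≈⟨ +-cong (*-congʳ (distribʳ α 1# 1#)) (*-identityˡ x) ⟩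
    (1# * α + 1# * α) * x + x         ≈⟨ +-congʳ (*-congʳ (+-cong (*-identityˡ α) (*-identityˡ α))) ⟩
    (α + α) * x + x                   ≈⟨ +-congʳ (distribʳ x α α) ⟩
    (α * x + α * x) + x               ≈⟨ +-congʳ (distribˡ α x x) ⟨
    α * (x + x) + x                   ∎
    where open ≤-Reasoning

  Terminal : Fin n → Set
  Terminal v = ∃[ i ] v ∈ Rs i

  terminal? : ∀ v → Dec (Terminal v)
  terminal? v = Fin.any? (λ i → v ∈? Rs i)

  visit-all : ∀ {s} (vs : List (Fin n)) t → Σ[ p ∈ Walk (whole G) s t ] (∀ {v} → v List.∈ vs → Visits v p)
  visit-all {s} [] t = connected s t , λ ()
  visit-all {s} (v ∷ vs) t with visit-all {v} vs t
  ... | p , all = connected s v ++ʷ p , λ where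
    (here ≡.refl) → visits-++ʳ (connected s v) (visits-start p)
    (there i)     → visits-++ʳ (connected s v) (all i)

  -- Any such walk will do, however long: it shows that the Steiner distance in `G` is finite.
  steiner-walk : ∀ s t → Σ[ p ∈ Walk (whole G) s t ] IsGroupSteiner Rs p
  steiner-walk s t with visit-all {s} (map (proj₁ ∘ Rs-nonempty) (allFin k)) t
  ... | p , all = p , λ i → proj₁ (Rs-nonempty i) , proj₂ (Rs-nonempty i) ,
                            all (∈-map⁺ (proj₁ ∘ Rs-nonempty) (∈-allFin i))

  module _ (i₀ : Fin k) (H : Subgraph G) (span : IsSpanning H)
           (Hs⊆H : ∀ i u v → T (edge (Hs i) u v) → T (edge H u v))
           (forests : ∀ i → ContainsForest (edge H) (Rs i)) where

    -- Follow the forest from s to its root r, then the spanner from r to a.  By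
    -- the choice of r and the triangle inequality, these have lengths at most
    -- ℓ and 2 α ℓ, where ℓ is the length of p.
    detour : ∀ {s a} → Terminal a → (p : Walk (whole G) s a) →
             Σ[ q ∈ Walk H s a ] walkLength q ≤ β * walkLength p
    detour {s} {a} (i , a∈R) p with forests i s
    ... | d , reach , min with reach⇒walk H span reach
    ... | r , r∈R , f , ≡.refl with embed {Y = whole G} (λ _ _ → ∈⊤) (edge-⊆ H) f
                             | spanners i r a r∈R a∈R
    ... | f′ , f′≡ | dX , dG , ((g , _ , g≈) , _) , (_ , dG≤) , dX≤ with embed {Y = H} (λ v _ → span v) (Hs⊆H i) g
    ... | g′ , g′≡ = f ++ʷ g′ , (begin
      walkLength (f ++ʷ g′)                        ≈⟨ ++-length f g′ ⟩
      walkLength f + walkLength g′                 ≈⟨ +-congˡ (trans (reflexive g′≡) g≈) ⟩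
      walkLength f + dX                            ≤⟨ +-mono-≤ f≤p (≤-trans dX≤ (*-monoʳ-≤ 0≤α dG≤2p)) ⟩
      walkLength p + α * (walkLength p + walkLength p) ≈⟨ +-comm _ _ ⟩
      α * (walkLength p + walkLength p) + walkLength p ≈⟨ β-* (walkLength p) ⟨
      β * walkLength p                             ∎)
      where
      open ≤-Reasoning
      f≤p : walkLength f ≤ walkLength p
      f≤p = min (walk⇒reach (whole G) p a∈R)
      dG≤2p : dG ≤ walkLength p + walkLength p
      dG≤2p = begin
        dG                                          ≤⟨ dG≤ (reverse f′ ++ʷ p) tt ⟩
        walkLength (reverse f′ ++ʷ p)               ≈⟨ ++-length (reverse f′) p ⟩
        walkLength (reverse f′) + walkLength p      ≈⟨ +-congʳ (trans (reverse-length f′) (reflexive f′≡)) ⟩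
        walkLength f + walkLength p                 ≤⟨ +-monoˡ-≤ _ f≤p ⟩
        walkLength p + walkLength p                 ∎

    -- Undirectedness: reversing the walk puts its terminal at the end, as `detour` requires.
    detour-from : ∀ {s a} → Terminal a → (p : Walk (whole G) a s) →
                  Σ[ q ∈ Walk H a s ] walkLength q ≤ β * walkLength p
    detour-from a p with detour a (reverse p)
    ... | q , len≤ = reverse q , ≤-respˡ-≈ (sym (reverse-length q)) (≤-respʳ-≈ (*-congˡ (reverse-length p)) len≤)

    β-++ : ∀ {s u t} (p : Walk (whole G) s u) (q : Walk (whole G) u t)
           (p′ : Walk H s u) (q′ : Walk H u t) →
           walkLength p′ ≤ β * walkLength p → walkLength q′ ≤ β * walkLength q →
           walkLength (p′ ++ʷ q′) ≤ β * walkLength (p ++ʷ q)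
    β-++ p q p′ q′ ≤p ≤q = begin
      walkLength (p′ ++ʷ q′)             ≈⟨ ++-length p′ q′ ⟩
      walkLength p′ + walkLength q′      ≤⟨ +-mono-≤ ≤p ≤q ⟩
      β * walkLength p + β * walkLength q ≈⟨ distribˡ β _ _ ⟨
      β * (walkLength p + walkLength q)  ≈⟨ *-congˡ (++-length p q) ⟨
      β * walkLength (p ++ʷ q)           ∎
      where open ≤-Reasoning

    ++-assoc-length : ∀ {s u v t} (p : Walk (whole G) s u) (e : T (Graph.edge G u v)) (q : Walk (whole G) v t) →
                walkLength ((p ++ʷ edge-walk e) ++ʷ q) ≈ walkLength (p ++ʷ step e q)
    ++-assoc-length (stop _)   e q = refl
    ++-assoc-length (step _ p) e q = +-congˡ (++-assoc-length p e q)

    Follows : ∀ {s u t} → Walk H s t → Walk (whole G) u t → Set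
    Follows q p = ∀ {v} → Terminal v → Visits v p → Visits v q

    -- q is the part of the walk since the last terminal a, and p the part to come.
    follow : ∀ {a u t} → Terminal a → (q : Walk (whole G) a u) (p : Walk (whole G) u t) →
             Σ[ h ∈ Walk H a t ] walkLength h ≤ β * walkLength (q ++ʷ p) × Follows h p
    -- The last piece starts at a terminal, so its end may be any vertex.
    follow a∈ q (stop u∈) with detour-from a∈ q
    ... | h , len≤ =
      h , ≤-trans len≤ (*-monoʳ-≤ 0≤β (≤-reflexive (sym (trans (++-length q (stop u∈)) (+-identityʳ _))))) ,
      λ { _ at-stop → visits-end h }
      where
      0≤β : 0# ≤ β
      0≤β = +-nonNegative (*-nonNegative (+-nonNegative 0≤1 0≤1) 0≤α) 0≤1
    follow {u = u} a∈ q (step e p) with terminal? u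
    ... | no u∉ with follow a∈ (q ++ʷ edge-walk e) p
    ...   | h , len≤ , fol = h , ≤-respʳ-≈ (*-congˡ (++-assoc-length q e p)) len≤ , λ where
      u∈ at-step     → ⊥-elim (u∉ u∈)
      v∈ (later vis) → fol v∈ vis
    -- `edge-walk e ++ʷ p` computes to `step e p`, so the bound from the recursive call already has
    -- the form that `β-++` expects.
    follow {u = u} a∈ q (step e p) | yes u∈ with detour-from a∈ q | follow u∈ (edge-walk e) p
    ... | h , ≤h | h′ , ≤h′ , fol = h ++ʷ h′ , β-++ q (step e p) h h′ ≤h ≤h′ , λ where
      _  at-step     → visits-++ʳ h (visits-start h′)
      v∈ (later vis) → visits-++ʳ h (fol v∈ vis)

    -- A search for the first terminal of the walk. The piece before it has its terminal at the end,
    -- hence `detour`; the remainder is left to `follow`. `Follows` mentions `p` alone, since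
    -- vertices are moved into `q` only when found not to be terminals.
    follow-from : ∀ {s u t} (q : Walk (whole G) s u) (p : Walk (whole G) u t) →
                  (∃[ v ] Terminal v × Visits v p) →
                  Σ[ h ∈ Walk H s t ] walkLength h ≤ β * walkLength (q ++ʷ p) × Follows h p
    follow-from {u = u} q p vp with terminal? u
    ... | yes u∈ with detour u∈ q | follow u∈ (stop ∈⊤) p
    ...   | h , ≤h | h′ , ≤h′ , fol =
      h ++ʷ h′ , β-++ q p h h′ ≤h ≤h′ , λ v∈ vis → visits-++ʳ h (fol v∈ vis)
    follow-from q (stop _)   (_ , v∈ , at-stop)   | no u∉ = ⊥-elim (u∉ v∈)
    follow-from q (step e p) (_ , v∈ , at-step)   | no u∉ = ⊥-elim (u∉ v∈)
    follow-from q (step e p) (v , v∈ , later vis) | no u∉ with follow-from (q ++ʷ edge-walk e) p (v , v∈ , vis)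
    ... | h , len≤ , fol = h , ≤-respʳ-≈ (*-congˡ (++-assoc-length q e p)) len≤ , λ where
      u∈ at-step     → ⊥-elim (u∉ u∈)
      v∈ (later vis) → fol v∈ vis

    isGroupSteinerSpanner : IsGroupSteinerSpanner G β Rs H
    isGroupSteinerSpanner = span , stretch
      where
      stretch : ∀ s t → _
      stretch s t with steinerDist (whole G) (λ _ → ∈⊤) t (proj₁ (steiner-walk s t)) (proj₂ (steiner-walk s t))
      ... | σG , (p , steiner , p≈) , minG
        with follow-from (stop ∈⊤) p (let v , v∈ , vis = steiner i₀ in v , (i₀ , v∈) , vis)
      ...   | h , len≤ , fol
        with steinerDist H span t h (λ i → let v , v∈ , vis = steiner i in v , v∈ , fol (i , v∈) vis)
      ...     | σH , (q , minH) = σH , σG , (q , minH) , ((p , steiner , p≈) , minG) ,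
        ≤-trans (minH h (λ i → let v , v∈ , vis = steiner i in v , v∈ , fol (i , v∈) vis))
                (≤-respʳ-≈ (*-congˡ p≈) len≤)

-- Programs

cell : ℕ → Exprᴺ
cell h = get (lit h ∷ [])

T-∧⁻ : ∀ a {b} → T (a ∧ b) → T a × T b
T-∧⁻ a = Equivalence.to (T-∧ {a})

addressAbove : ℕ → List Exprᴺ → Bool
addressAbove a (lit h ∷ _) = a <ᵇ h
addressAbove a _           = false

-- A syntactic check by array number that evaluates on a concrete program, so that its proof there
-- is `tt`. Setting a loop counter counts as a write, and an address not headed by a literal is
-- rejected.
writesAbove : ℕ → ℕ → Program → Bool
writesAbove a b skip                    = true
writesAbove a b (x := _)                = addressAbove a x
writesAbove a b (x :=ᵂ _)               = addressAbove b x
writesAbove a b (P ⨾ Q)                 = writesAbove a b P ∧ writesAbove a b Q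
writesAbove a b (ifᵖ _ then P else Q)   = writesAbove a b P ∧ writesAbove a b Q
writesAbove a b (for x below _ run P)   = (a <ᵇ x) ∧ writesAbove a b P

-- The sizes n and k are cells 0 and 1.
isSize : Exprᴺ → Bool
isSize (get (lit 0 ∷ [])) = true
isSize (get (lit 1 ∷ [])) = true
isSize _                  = false

loopsOverSizes : Program → Bool
loopsOverSizes (P ⨾ Q)               = loopsOverSizes P ∧ loopsOverSizes Q
loopsOverSizes (ifᵖ _ then P else Q) = loopsOverSizes P ∧ loopsOverSizes Q
loopsOverSizes (for _ below e run P) = isSize e ∧ loopsOverSizes P
loopsOverSizes _                     = true

-- Together with `degree` this gives the crude bound of `cost-≤`. The 2 for a loop pays for its
-- set-up and for its counter updates, at most `N ^ (1 + degree P)` each. Degrees are added, not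
-- maximised, under sequencing and branching, so that comparing powers takes only `power-≤ˡ` and
-- `power-≤ʳ`.
coefficient : Program → ℕ
coefficient (P ⨾ Q)               = coefficient P ℕ.+ coefficient Q
coefficient (ifᵖ _ then P else Q) = 1 ℕ.+ (coefficient P ℕ.+ coefficient Q)
coefficient (for _ below _ run P) = 2 ℕ.+ coefficient P
coefficient _                     = 1

degree : Program → ℕ
degree (P ⨾ Q)               = degree P ℕ.+ degree Q
degree (ifᵖ _ then P else Q) = degree P ℕ.+ degree Q
degree (for _ below _ run P) = 1 ℕ.+ degree P
degree _                     = 0

-- Frame rule, loop rules and cost bounds

module ProgramLogic {c ℓ₁ ℓ₂ : Level} (K : OrderedCommutativeRing c ℓ₁ ℓ₂) where
  open Memory

  module _ {a} {A : Set a} where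

    update-same : ∀ (f : Address → A) {x z : Address} (y : A) → x ≡ z → update {K = K} f x y z ≡ y
    update-same f {x} {z} y x≡z with ≡-dec ℕ._≟_ x z
    ... | yes _   = ≡.refl
    ... | no  x≢z = ⊥-elim (x≢z x≡z)

    update-other : ∀ (f : Address → A) {x z : Address} (y : A) → x ≢ z → update {K = K} f x y z ≡ f z
    update-other f {x} {z} y x≢z with ≡-dec ℕ._≟_ x z
    ... | yes x≡z = ⊥-elim (x≢z x≡z)
    ... | no  _   = ≡.refl

    update-above : ∀ (f : Address → A) {a h h' t t'} (y : A) → T (a <ᵇ h') → h ℕ.≤ a →
                   update {K = K} f (h' ∷ t') y (h ∷ t) ≡ f (h ∷ t)
    update-above f {a} {h} {h'} y a<h' h≤a =
      update-other f y λ eq → ℕ.<⇒≢ (ℕ.≤-<-trans h≤a (ℕ.<ᵇ⇒< a h' a<h')) (≡.sym (∷-injectiveˡ eq))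

  record Agree (a b : ℕ) (m m' : Memory K) : Set c where
    constructor agree
    field
      onNats    : ∀ {h t} → h ℕ.≤ a → nats m' (h ∷ t) ≡ nats m (h ∷ t)
      onWeights : ∀ {h t} → h ℕ.≤ b → weights m' (h ∷ t) ≡ weights m (h ∷ t)
  open Agree public

  agree-refl : ∀ {a b m} → Agree a b m m
  agree-refl = agree (λ _ → ≡.refl) (λ _ → ≡.refl)

  agree-trans : ∀ {a b m m' m″} → Agree a b m m' → Agree a b m' m″ → Agree a b m m″
  agree-trans p q = agree (λ h≤ → ≡.trans (onNats q h≤) (onNats p h≤))
                          (λ h≤ → ≡.trans (onWeights q h≤) (onWeights p h≤))

  agree-weaken : ∀ {a b a' b' m m'} → a' ℕ.≤ a → b' ℕ.≤ b → Agree a b m m' → Agree a' b' m m'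
  agree-weaken a'≤a b'≤b p = agree (λ h≤ → onNats p (ℕ.≤-trans h≤ a'≤a))
                                   (λ h≤ → onWeights p (ℕ.≤-trans h≤ b'≤b))

  set-agree : ∀ {a b h t m} y → T (a <ᵇ h) → Agree a b m (setᴺ (h ∷ t) y m)
  set-agree {m = m} y a<h = agree (update-above (nats m) y a<h) (λ _ → ≡.refl)

  mutual
    -- The frame rule: a written address differs from every protected one already in its array
    -- number, which is its first entry.
    frame : ∀ {a b} P m → T (writesAbove a b P) → Agree a b m (exec P m)
    frame skip m _ = agree-refl
    frame ((lit h ∷ es) := e) m w = set-agree (evalᴺ m e) w
    frame ((lit h ∷ es) :=ᵂ e) m w = agree (λ _ → ≡.refl) (update-above (weights m) (evalᵂ m e) w)
    frame {a} {b} (P ⨾ Q) m w with T-∧⁻ (writesAbove a b P) w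
    ... | wP , wQ = agree-trans (frame P m wP) (frame Q (exec P m) wQ)
    frame {a} {b} (ifᵖ t then P else Q) m w with evalTest m t | T-∧⁻ (writesAbove a b P) w
    ... | true  | wP , _ = frame P m wP
    ... | false | _ , wQ = frame Q m wQ
    frame {a} {b} (for x below e run P) m w with T-∧⁻ (a <ᵇ x) w
    ... | wx , wP = frame-for x P (evalᴺ m e) m wx wP

    frame-for : ∀ {a b} x P j m → T (a <ᵇ x) → T (writesAbove a b P) → Agree a b m (execFor x P j m)
    frame-for x P zero m _ _ = agree-refl
    frame-for {a} {b} x P (suc j) m wx wP =
      agree-trans (frame-for x P j m wx wP)
        (agree-trans (set-agree j wx) (frame P (setᴺ (x ∷ []) j (execFor x P j m)) wP))

  -- True by computation, but the conversion checker is slow at finding out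
  -- unless Q is given.
  seq-intro : ∀ {q} (Q : Memory K → Set q) P P' m → Q (exec P' (exec P m)) → Q (exec (P ⨾ P') m)
  seq-intro Q P P' m q = q

  if-elim : ∀ {q} (Q : Memory K → Set q) t P P' m →
            (T (evalTest m t) → Q (exec P m)) → (¬ T (evalTest m t) → Q (exec P' m)) →
            Q (exec (ifᵖ t then P else P') m)
  if-elim Q t P P' m p p' with evalTest m t
  ... | true  = p _
  ... | false = p' id

  -- The body receives its index as an element of `Fin N`, so that it can name a vertex or a group;
  -- the induction itself runs over naturals.
  for-invariant : ∀ {i} x e P N (I : ℕ → Memory K → Set i) →
                  (∀ (j : Fin N) m → I (toℕ j) m → I (suc (toℕ j)) (exec P (setᴺ (x ∷ []) (toℕ j) m))) →
                  ∀ m → evalᴺ m e ≡ N → I 0 m → I N (exec (for x below e run P) m)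
  for-invariant x e P N I body m e≡N init rewrite e≡N = go N ℕ.≤-refl
    where
    go : ∀ j → j ℕ.≤ N → I j (execFor x P j m)
    go zero    _   = init
    go (suc j) j<N = ≡.subst (λ l → I (suc l) (exec P (setᴺ (x ∷ []) l (execFor x P j m))))
      (Fin.toℕ-fromℕ< j<N)
      (body (fromℕ< j<N) (execFor x P j m)
        (≡.subst (λ l → I l (execFor x P j m)) (≡.sym (Fin.toℕ-fromℕ< j<N)) (go j (ℕ.<⇒≤ j<N))))

  -- For loops whose round `j` establishes a fact `Q j` of its own. Every round moves upwards in `⊑`
  -- and each `Q j` is upward closed, so all the facts still hold at the end.
  for-each : ∀ {i r q} x e P N (I : Memory K → Set i) (_⊑_ : Memory K → Memory K → Set r)
             (Q : Fin N → Memory K → Set q) →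
             (∀ {m} → m ⊑ m) → (∀ {m m' m″} → m ⊑ m' → m' ⊑ m″ → m ⊑ m″) →
             (∀ j {m m'} → m ⊑ m' → Q j m → Q j m') →
             (∀ j m → I m → let m' = exec P (setᴺ (x ∷ []) (toℕ j) m) in I m' × m ⊑ m' × Q j m') →
             ∀ m → evalᴺ m e ≡ N → I m →
             let m' = exec (for x below e run P) m in I m' × m ⊑ m' × (∀ j → Q j m')
  for-each x e P N I _⊑_ Q ⊑-refl ⊑-trans Q-mono body m e≡N init
    with for-invariant x e P N
           (λ j m' → I m' × m ⊑ m' × (∀ (l : Fin N) → toℕ l ℕ.< j → Q l m'))
           (λ j m' (Im' , m⊑ , Qs) → let Im″ , m'⊑ , Qj = body j m' Im' in
              Im″ , ⊑-trans m⊑ m'⊑ , λ l l<sj →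
                [ (λ l<j → Q-mono l m'⊑ (Qs l l<j))
                , (λ l≡j → ≡.subst (λ l → Q l _) (≡.sym (Fin.toℕ-injective l≡j)) Qj) ]′
                (ℕ.m<1+n⇒m<n∨m≡n l<sj))
           m e≡N (init , ⊑-refl , λ _ ())
  ... | Im' , m⊑ , Qs = Im' , m⊑ , λ j → Qs j (Fin.toℕ<n j)

  module _ (N : ℕ) .{{_ : NonZero N}} where

    Bounded : Memory K → Set
    Bounded m = nats m (0 ∷ []) ℕ.≤ N × nats m (1 ∷ []) ℕ.≤ N

    bounded-agree : ∀ {b m m'} → Agree 1 b m m' → Bounded m → Bounded m'
    bounded-agree A (n≤ , k≤) = ≡.subst (ℕ._≤ N) (≡.sym (onNats A ℕ.z≤n)) n≤ ,
                                ≡.subst (ℕ._≤ N) (≡.sym (onNats A ℕ.≤-refl)) k≤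

    size≤N : ∀ e {m} → T (isSize e) → Bounded m → evalᴺ m e ℕ.≤ N
    size≤N (get (lit 0 ∷ [])) _ (n≤ , _) = n≤
    size≤N (get (lit 1 ∷ [])) _ (_ , k≤) = k≤

    power-≤ˡ : ∀ a {d d'} → a ℕ.* N ^ d ℕ.≤ a ℕ.* N ^ (d ℕ.+ d')
    power-≤ˡ a {d} {d'} = ℕ.*-monoʳ-≤ a (ℕ.^-monoʳ-≤ N (ℕ.m≤m+n d d'))

    power-≤ʳ : ∀ a {d d'} → a ℕ.* N ^ d' ℕ.≤ a ℕ.* N ^ (d ℕ.+ d')
    power-≤ʳ a {d} {d'} = ℕ.*-monoʳ-≤ a (ℕ.^-monoʳ-≤ N (ℕ.m≤n+m d' d))

    1≤power : ∀ d → 1 ℕ.≤ N ^ d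
    1≤power d = ℕ.m^n>0 N d

    mutual
      -- Cells 0 and 1 are never written, so at each loop entry the number of rounds is still at
      -- most `N`. As `N` is non-zero, its powers grow with the exponent and absorb the unit costs.
      cost-≤ : ∀ {b} P m → T (writesAbove 1 b P) → T (loopsOverSizes P) → Bounded m →
               cost P m ℕ.≤ coefficient P ℕ.* N ^ degree P
      cost-≤ skip m _ _ _ = ℕ.≤-refl
      cost-≤ (_ := _) m _ _ _ = ℕ.≤-refl
      cost-≤ (_ :=ᵂ _) m _ _ _ = ℕ.≤-refl
      cost-≤ {b} (P ⨾ Q) m w l B with T-∧⁻ (writesAbove 1 b P) w | T-∧⁻ (loopsOverSizes P) l
      ... | wP , wQ | lP , lQ = begin
        cost P m ℕ.+ cost Q (exec P m)
          ≤⟨ ℕ.+-mono-≤ (cost-≤ P m wP lP B) (cost-≤ Q (exec P m) wQ lQ (bounded-agree (frame P m wP) B)) ⟩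
        coefficient P ℕ.* N ^ degree P ℕ.+ coefficient Q ℕ.* N ^ degree Q
          ≤⟨ ℕ.+-mono-≤ (power-≤ˡ (coefficient P) {degree P} {degree Q}) (power-≤ʳ (coefficient Q) {degree P} {degree Q}) ⟩
        coefficient P ℕ.* N ^ D ℕ.+ coefficient Q ℕ.* N ^ D
          ≡⟨ ℕ.*-distribʳ-+ (N ^ D) (coefficient P) (coefficient Q) ⟨
        (coefficient P ℕ.+ coefficient Q) ℕ.* N ^ D ∎
        where
        open ℕ.≤-Reasoning
        D : ℕ
        D = degree P ℕ.+ degree Q
      cost-≤ {b} (ifᵖ t then P else Q) m w l B with T-∧⁻ (writesAbove 1 b P) w | T-∧⁻ (loopsOverSizes P) l
      ... | wP , wQ | lP , lQ = ℕ.+-mono-≤ (1≤power D) branch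
        where
        open ℕ.≤-Reasoning
        D : ℕ
        D = degree P ℕ.+ degree Q
        branch : (if evalTest m t then cost P m else cost Q m) ℕ.≤ (coefficient P ℕ.+ coefficient Q) ℕ.* N ^ D
        branch with evalTest m t
        ... | true = ℕ.≤-trans (cost-≤ P m wP lP B) (ℕ.≤-trans (power-≤ˡ (coefficient P) {degree P} {degree Q})
                       (ℕ.*-monoˡ-≤ (N ^ D) (ℕ.m≤m+n (coefficient P) (coefficient Q))))
        ... | false = ℕ.≤-trans (cost-≤ Q m wQ lQ B) (ℕ.≤-trans (power-≤ʳ (coefficient Q) {degree P} {degree Q})
                       (ℕ.*-monoˡ-≤ (N ^ D) (ℕ.m≤n+m (coefficient Q) (coefficient P))))
      cost-≤ {b} (for x below e run P) m w l B with T-∧⁻ (1 <ᵇ x) w | T-∧⁻ (isSize e) l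
      ... | wx , wP | le , lP = begin
        1 ℕ.+ costFor x P (evalᴺ m e) m
          ≤⟨ ℕ.+-monoʳ-≤ 1 (costFor-≤ x P (evalᴺ m e) m wx wP lP B) ⟩
        1 ℕ.+ evalᴺ m e ℕ.* (1 ℕ.+ C)
          ≤⟨ ℕ.+-monoʳ-≤ 1 (ℕ.*-monoˡ-≤ (1 ℕ.+ C) (size≤N e le B)) ⟩
        1 ℕ.+ N ℕ.* (1 ℕ.+ C)
          ≤⟨ ℕ.+-mono-≤ (1≤power (1 ℕ.+ degree P)) (ℕ.*-monoʳ-≤ N (ℕ.+-monoˡ-≤ C (1≤power (degree P)))) ⟩
        N ^ (1 ℕ.+ degree P) ℕ.+ N ℕ.* ((1 ℕ.+ coefficient P) ℕ.* N ^ degree P)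
          ≡⟨ ≡.cong (N ^ (1 ℕ.+ degree P) ℕ.+_) (swap N (1 ℕ.+ coefficient P) (N ^ degree P)) ⟩
        (2 ℕ.+ coefficient P) ℕ.* N ^ (1 ℕ.+ degree P) ∎
        where
        open ℕ.≤-Reasoning
        C : ℕ
        C = coefficient P ℕ.* N ^ degree P
        swap : ∀ x y z → x ℕ.* (y ℕ.* z) ≡ y ℕ.* (x ℕ.* z)
        swap x y z = ≡.trans (≡.sym (ℕ.*-assoc x y z))
                       (≡.trans (≡.cong (ℕ._* z) (ℕ.*-comm x y)) (ℕ.*-assoc y x z))

      costFor-≤ : ∀ {b} x P j m → T (1 <ᵇ x) → T (writesAbove 1 b P) → T (loopsOverSizes P) → Bounded m →
                  costFor x P j m ℕ.≤ j ℕ.* (1 ℕ.+ coefficient P ℕ.* N ^ degree P)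
      costFor-≤ x P zero m _ _ _ _ = ℕ.z≤n
      costFor-≤ {b} x P (suc j) m wx wP lP B = begin
        costFor x P j m ℕ.+ (1 ℕ.+ cost P m')
          ≤⟨ ℕ.+-mono-≤ (costFor-≤ x P j m wx wP lP B) (ℕ.+-monoʳ-≤ 1 (cost-≤ P m' wP lP bounded′)) ⟩
        j ℕ.* C ℕ.+ C
          ≡⟨ ℕ.+-comm (j ℕ.* C) C ⟩
        C ℕ.+ j ℕ.* C ∎
        where
        open ℕ.≤-Reasoning
        C : ℕ
        C = 1 ℕ.+ coefficient P ℕ.* N ^ degree P
        m' : Memory K
        m' = setᴺ (x ∷ []) j (execFor x P j m)
        bounded′ : Bounded m'
        bounded′ = bounded-agree {b = b} (agree-trans (frame-for x P j m wx wP) (set-agree j wx)) B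

-- The algorithm

isSet : List Exprᴺ → Test
isSet es = leq (lit 1) (get es)

addEdge : ℕ → ℕ → Program
addEdge p q = (lit 6 ∷ cell p ∷ cell q ∷ []) := lit 1 ⨾ (lit 6 ∷ cell q ∷ cell p ∷ []) := lit 1

-- Cells 8 to 11 are loop variables.

copyEdge : Program
copyEdge = ifᵖ isSet (lit 5 ∷ cell 8 ∷ cell 9 ∷ cell 10 ∷ []) then addEdge 9 10 else skip

copyEdges : Program
copyEdges = for 8 below cell 1 run for 9 below cell 0 run for 10 below cell 0 run copyEdge

-- In round i, array 7 marks the vertices settled so far, and weight array 1
-- holds their distances to R_i.

initialiseVertex : Program
initialiseVertex = (lit 7 ∷ cell 10 ∷ []) := get (lit 3 ∷ cell 8 ∷ cell 10 ∷ []) ⨾ (lit 1 ∷ cell 10 ∷ []) :=ᵂ zeroᵂ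

initialise : Program
initialise = for 10 below cell 0 run initialiseVertex

-- The best edge so far leads from cell 13 (unsettled) to cell 14 (settled), and
-- its key is weight cell 2; cell 12 says whether there is one.

isCrossing : Test
isCrossing = conj (neg (isSet (lit 7 ∷ cell 10 ∷ [])))
  (conj (isSet (lit 7 ∷ cell 11 ∷ [])) (isSet (lit 2 ∷ cell 10 ∷ cell 11 ∷ [])))

keyᴱ : Exprᵂ
keyᴱ = addᵂ (getᵂ (lit 0 ∷ cell 10 ∷ cell 11 ∷ [])) (getᵂ (lit 1 ∷ cell 11 ∷ []))

record-best : Program
record-best = (lit 12 ∷ []) := lit 1 ⨾ (lit 2 ∷ []) :=ᵂ keyᴱ ⨾ (lit 13 ∷ []) := cell 10 ⨾ (lit 14 ∷ []) := cell 11

hasBetter : Test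
hasBetter = conj (isSet (lit 12 ∷ [])) (leqᵂ (getᵂ (lit 2 ∷ [])) keyᴱ)

examine : Program
examine = ifᵖ isCrossing then (ifᵖ hasBetter then skip else record-best) else skip

scan : Program
scan = for 10 below cell 0 run for 11 below cell 0 run examine

markBest : Program
markBest = (lit 7 ∷ cell 13 ∷ []) := lit 1 ⨾ (lit 1 ∷ cell 13 ∷ []) :=ᵂ getᵂ (lit 2 ∷ [])

settleBest : Program
settleBest = markBest ⨾ addEdge 13 14

settleIfFound : Program
settleIfFound = ifᵖ isSet (lit 12 ∷ []) then settleBest else skip

growStep : Program
growStep = (lit 12 ∷ []) := lit 0 ⨾ scan ⨾ settleIfFound

-- Each step settles a vertex or finds that none is left, so `n` steps suffice whatever the size of
-- the group.
grow : Program
grow = for 9 below cell 0 run growStep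

growForests : Program
growForests = for 8 below cell 1 run (initialise ⨾ grow)

algorithm : Program
algorithm = copyEdges ⨾ growForests

-- Reading memory entries as truth values, and counting edges

T-bit : ∀ {b x} → x ≡ bit b → T (1 ≤ᵇ x) → T b
T-bit {true} _ _ = _
T-bit {false} ≡.refl ()

bit-T : ∀ {b x} → x ≡ bit b → T b → T (1 ≤ᵇ x)
bit-T {true} ≡.refl _ = _

T-not⁻ : ∀ b → T (not b) → ¬ T b
T-not⁻ false _ ()

T-not⁺ : ∀ b → ¬ T b → T (not b)
T-not⁺ true  ¬b = ¬b _
T-not⁺ false _  = _

at-toℕ : ∀ {a} {A : Set a} {n} (f : Fin n → A) d i → at f d (toℕ i) ≡ f i
at-toℕ {n = n} f d i with toℕ i ℕ.<? n
... | yes i<n = ≡.cong f (Fin.fromℕ<-toℕ i i<n)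
... | no  i≮n = ⊥-elim (i≮n (Fin.toℕ<n i))

-- The counted pairs form a list without repetitions, so any list that covers them is at least as
-- long. `L` may contain repetitions and pairs that are not edges.
edgeCount-≤ : ∀ {n} (e : Fin n → Fin n → Bool) (L : List (Fin n × Fin n)) →
              (∀ u v → toℕ u ℕ.< toℕ v → T (e u v) → (u , v) List.∈ L) → edgeCount e ℕ.≤ length L
edgeCount-≤ {n} e L cover = unique-length-≤
  (Unique.filter⁺ (λ x → T? (listed x)) (Unique.cartesianProduct⁺ (Unique.allFin⁺ n) (Unique.allFin⁺ n)))
  λ {x} x∈ → let u<v , uv = Equivalence.to (T-∧ {toℕ (proj₁ x) <ᵇ toℕ (proj₂ x)})
                              (proj₂ (∈-filter⁻ (λ x → T? (listed x)) {xs = cartesianProduct (allFin n) (allFin n)} x∈))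
             in cover (proj₁ x) (proj₂ x) (ℕ.<ᵇ⇒< _ _ u<v) uv
  where
  listed : Fin n × Fin n → Bool
  listed (u , v) = (toℕ u <ᵇ toℕ v) ∧ e u v

-- Invariants of the memory and of the output matrix

module Correctness {c ℓ₁ ℓ₂ : Level} (K : OrderedCommutativeRing c ℓ₁ ℓ₂) {n k : ℕ} (G : Graph K n)
  (Rs : Fin k → Subset n) (Hs : Fin k → Subgraph G) where
  open OrderedCommutativeRing K using (0#)
  open Graph G using (edge; weight)
  open Memory
  open ProgramLogic K

  m₀ : Memory K
  m₀ = input {G = G} Rs Hs

  input-edge : ∀ u v → nats m₀ (2 ∷ toℕ u ∷ toℕ v ∷ []) ≡ bit (edge u v)
  input-edge u v = ≡.trans (at-toℕ _ 0 u) (at-toℕ _ 0 v)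

  input-R : ∀ i v → nats m₀ (3 ∷ toℕ i ∷ toℕ v ∷ []) ≡ bit (Vec.lookup (Rs i) v)
  input-R i v = ≡.trans (at-toℕ _ 0 i) (at-toℕ _ 0 v)

  input-Hs : ∀ i u v → nats m₀ (5 ∷ toℕ i ∷ toℕ u ∷ toℕ v ∷ []) ≡ bit (Subgraph.edge (Hs i) u v)
  input-Hs i u v = ≡.trans (at-toℕ _ 0 i) (≡.trans (at-toℕ _ 0 u) (at-toℕ _ 0 v))

  input-weight : ∀ u v → weights m₀ (0 ∷ toℕ u ∷ toℕ v ∷ []) ≡ weight u v
  input-weight u v = ≡.trans (at-toℕ _ 0# u) (at-toℕ _ 0# v)

  adj : Memory K → Fin n → Fin n → Bool
  adj m u v = 1 ≤ᵇ nats m (6 ∷ toℕ u ∷ toℕ v ∷ [])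

  infix 4 _⊑_
  _⊑_ : Memory K → Memory K → Set
  m ⊑ m' = ∀ u v → T (adj m u v) → T (adj m' u v)

  -- `intact` protects the input, which every later round still reads; `entry≤1` is what turns the
  -- matrix into the bits that `Outputs` demands.
  record Valid (m : Memory K) : Set c where
    field
      intact : Agree 5 0 m₀ m
      entry≤1 : ∀ (u v : Fin n) → nats m (6 ∷ toℕ u ∷ toℕ v ∷ []) ℕ.≤ 1
      adj-sym : ∀ (u v : Fin n) → nats m (6 ∷ toℕ u ∷ toℕ v ∷ []) ≡ nats m (6 ∷ toℕ v ∷ toℕ u ∷ [])
      adj-⊆   : ∀ u v → T (adj m u v) → T (edge u v)
  open Valid

  valid-agree : ∀ {m m'} → Agree 6 0 m m' → Valid m → Valid m'
  valid-agree {m} {m'} A V = record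
    { intact  = agree-trans (intact V) (agree-weaken (ℕ.n≤1+n 5) z≤n A)
    ; entry≤1 = λ u v → ≡.subst (ℕ._≤ 1) (≡.sym (same u v)) (entry≤1 V u v)
    ; adj-sym = λ u v → ≡.trans (same u v) (≡.trans (adj-sym V u v) (≡.sym (same v u)))
    ; adj-⊆   = λ u v → adj-⊆ V u v ∘ ≡.subst (λ x → T (1 ≤ᵇ x)) (same u v)
    }
    where
    same : ∀ (u v : Fin n) → nats m' (6 ∷ toℕ u ∷ toℕ v ∷ []) ≡ nats m (6 ∷ toℕ u ∷ toℕ v ∷ [])
    same u v = onNats A ℕ.≤-refl

  n-cell : ∀ {m} → Agree 5 0 m₀ m → nats m (0 ∷ []) ≡ n
  n-cell A = onNats A z≤n

  k-cell : ∀ {m} → Agree 5 0 m₀ m → nats m (1 ∷ []) ≡ k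
  k-cell A = onNats A (s≤s z≤n)

  Joins : Fin n → Fin n → Fin n → Fin n → Set
  Joins u v a b = (a ≡ u × b ≡ v) ⊎ (a ≡ v × b ≡ u)

  AddsEdge : Fin n → Fin n → Memory K → Memory K → Set
  AddsEdge u v m m' = ∀ a b →
    (Joins u v a b × nats m' (6 ∷ toℕ a ∷ toℕ b ∷ []) ≡ 1) ⊎
    (¬ Joins u v a b × nats m' (6 ∷ toℕ a ∷ toℕ b ∷ []) ≡ nats m (6 ∷ toℕ a ∷ toℕ b ∷ []))

  addEdge-spec : ∀ {m u v} p q → nats m (p ∷ []) ≡ toℕ u → nats m (q ∷ []) ≡ toℕ v →
                 AddsEdge u v m (exec (addEdge p q) m)
  addEdge-spec {m} {u} {v} p q p≡u q≡v a b = go first≡ second≡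
    where
    first second : Address
    first  = evalAddress m (lit 6 ∷ cell p ∷ cell q ∷ [])
    second = evalAddress (setᴺ first 1 m) (lit 6 ∷ cell q ∷ cell p ∷ [])

    first≡ : first ≡ 6 ∷ toℕ u ∷ toℕ v ∷ []
    first≡ = ≡.cong₂ (λ x y → 6 ∷ x ∷ y ∷ []) p≡u q≡v

    -- The second address is evaluated after the first write. That write goes to an address with
    -- three entries and so cannot change the cells `p` and `q`.
    second≡ : second ≡ 6 ∷ toℕ v ∷ toℕ u ∷ []
    second≡ = ≡.cong₂ (λ x y → 6 ∷ x ∷ y ∷ [])
      (≡.trans (update-other (nats m) {first} {q ∷ []} 1 λ ()) q≡v)
      (≡.trans (update-other (nats m) {first} {p ∷ []} 1 λ ()) p≡u)

    injective : ∀ {x y z w : Fin n} → (6 ∷ toℕ x ∷ toℕ y ∷ []) ≡ (6 ∷ toℕ z ∷ toℕ w ∷ []) → x ≡ z × y ≡ w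
    injective eq = Fin.toℕ-injective (∷-injectiveˡ (∷-injectiveʳ eq)) ,
                   Fin.toℕ-injective (∷-injectiveˡ (∷-injectiveʳ (∷-injectiveʳ eq)))

    f : Address → ℕ
    f = nats m

    -- Generalising both addresses allows matching on their equations, after which the nested
    -- `update` is resolved by deciding equality of concrete addresses.
    go : ∀ {A B} → A ≡ 6 ∷ toℕ u ∷ toℕ v ∷ [] → B ≡ 6 ∷ toℕ v ∷ toℕ u ∷ [] →
         let z = 6 ∷ toℕ a ∷ toℕ b ∷ []
             x = update {K = K} (update {K = K} f A 1) B 1 z
         in (Joins u v a b × x ≡ 1) ⊎ (¬ Joins u v a b × x ≡ f z)
    go ≡.refl ≡.refl with ≡-dec ℕ._≟_ (6 ∷ toℕ v ∷ toℕ u ∷ []) (6 ∷ toℕ a ∷ toℕ b ∷ [])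
    ... | yes eq = inj₁ (inj₂ (injective (≡.sym eq)) , ≡.refl)
    ... | no ≢₂ with ≡-dec ℕ._≟_ (6 ∷ toℕ u ∷ toℕ v ∷ []) (6 ∷ toℕ a ∷ toℕ b ∷ [])
    ...   | yes eq = inj₁ (inj₁ (injective (≡.sym eq)) , ≡.refl)
    ...   | no ≢₁  = inj₂ ((λ { (inj₁ (≡.refl , ≡.refl)) → ≢₁ ≡.refl
                              ; (inj₂ (≡.refl , ≡.refl)) → ≢₂ ≡.refl }) , ≡.refl)

  module EdgeAdded {m m' : Memory K} {u v : Fin n} (entry : AddsEdge u v m m') where

    joins-sym : ∀ {a b} → Joins u v a b → Joins u v b a
    joins-sym (inj₁ (a≡u , b≡v)) = inj₂ (b≡v , a≡u)
    joins-sym (inj₂ (a≡v , b≡u)) = inj₁ (b≡u , a≡v)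

    adj-mono : m ⊑ m'
    adj-mono a b ab with entry a b
    ... | inj₁ (_ , eq) = ≡.subst (λ x → T (1 ≤ᵇ x)) (≡.sym eq) tt
    ... | inj₂ (_ , eq) = ≡.subst (λ x → T (1 ≤ᵇ x)) (≡.sym eq) ab

    adj-new : T (adj m' u v)
    adj-new with entry u v
    ... | inj₁ (_ , eq) = ≡.subst (λ x → T (1 ≤ᵇ x)) (≡.sym eq) tt
    ... | inj₂ (¬j , _) = ⊥-elim (¬j (inj₁ (≡.refl , ≡.refl)))

    adj-inv : ∀ {a b} → T (adj m' a b) → Joins u v a b ⊎ T (adj m a b)
    adj-inv {a} {b} ab with entry a b
    ... | inj₁ (j , _)  = inj₁ j
    ... | inj₂ (_ , eq) = inj₂ (≡.subst (λ x → T (1 ≤ᵇ x)) eq ab)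

    valid : T (edge u v) → Agree 5 0 m m' → Valid m → Valid m'
    valid uv A V = record
      { intact  = agree-trans (intact V) A
      ; entry≤1 = ≤1
      ; adj-sym = symmetric
      ; adj-⊆   = ⊆
      }
      where
      ≤1 : ∀ a b → nats m' (6 ∷ toℕ a ∷ toℕ b ∷ []) ℕ.≤ 1
      ≤1 a b with entry a b
      ... | inj₁ (_ , eq) = ≡.subst (ℕ._≤ 1) (≡.sym eq) ℕ.≤-refl
      ... | inj₂ (_ , eq) = ≡.subst (ℕ._≤ 1) (≡.sym eq) (entry≤1 V a b)
      symmetric : ∀ a b → nats m' (6 ∷ toℕ a ∷ toℕ b ∷ []) ≡ nats m' (6 ∷ toℕ b ∷ toℕ a ∷ [])
      symmetric a b with entry a b | entry b a
      ... | inj₁ (_ , p)  | inj₁ (_ , q)  = ≡.trans p (≡.sym q)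
      ... | inj₁ (j , _)  | inj₂ (¬j , _) = ⊥-elim (¬j (joins-sym j))
      ... | inj₂ (¬j , _) | inj₁ (j , _)  = ⊥-elim (¬j (joins-sym j))
      ... | inj₂ (_ , p)  | inj₂ (_ , q)  = ≡.trans p (≡.trans (adj-sym V a b) (≡.sym q))
      ⊆ : ∀ a b → T (adj m' a b) → T (edge a b)
      ⊆ a b ab with adj-inv ab
      ... | inj₁ (inj₁ (≡.refl , ≡.refl)) = uv
      ... | inj₁ (inj₂ (≡.refl , ≡.refl)) = ≡.subst T (Graph.edge-sym G u v) uv
      ... | inj₂ ab′ = adj-⊆ V a b ab′

  -- Copying the edges of the given spanners

  union : Fin n → Fin n → Bool
  union u v = any (λ i → Subgraph.edge (Hs i) u v) (allFin k)

  ∈-union : ∀ i {u v} → T (Subgraph.edge (Hs i) u v) → T (union u v)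
  ∈-union i uv = any⁺ _ (List.lose (∈-allFin i) uv)

  InUnion : Memory K → Set
  InUnion m = ∀ u v → T (adj m u v) → T (union u v)

  ContainsHs : Memory K → Set
  ContainsHs m = ∀ i u v → T (Subgraph.edge (Hs i) u v) → T (adj m u v)

  Copying : Memory K → Set c
  Copying m = Valid m × InUnion m

  copyEdge-spec : ∀ {m} i u v → nats m (8 ∷ []) ≡ toℕ i → nats m (9 ∷ []) ≡ toℕ u → nats m (10 ∷ []) ≡ toℕ v →
    Copying m → let m' = exec copyEdge m in
    (Copying m' × nats m' (8 ∷ []) ≡ toℕ i × nats m' (9 ∷ []) ≡ toℕ u) × m ⊑ m' ×
    (T (Subgraph.edge (Hs i) u v) → T (adj m' u v))
  copyEdge-spec {m} i u v ≡i ≡u ≡v (V , U) =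
    if-elim (λ m' → (Copying m' × nats m' (8 ∷ []) ≡ toℕ i × nats m' (9 ∷ []) ≡ toℕ u) × m ⊑ m' ×
                    (T (Subgraph.edge (Hs i) u v) → T (adj m' u v)))
      (isSet (lit 5 ∷ cell 8 ∷ cell 9 ∷ cell 10 ∷ [])) (addEdge 9 10) skip m
      (λ t → let uv = T-bit read t in
        ((valid (Subgraph.edge-⊆ (Hs i) u v uv) (frame (addEdge 9 10) m tt) V , inUnion uv) , ≡i , ≡u) ,
        adj-mono , λ _ → adj-new)
      (λ ¬t → ((V , U) , ≡i , ≡u) , (λ _ _ → id) , λ uv → ⊥-elim (¬t (bit-T read uv)))
    where
    m' : Memory K
    m' = exec (addEdge 9 10) m
    open EdgeAdded {m} {m'} (addEdge-spec {m} {u} {v} 9 10 ≡u ≡v)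
    read : nats m (5 ∷ nats m (8 ∷ []) ∷ nats m (9 ∷ []) ∷ nats m (10 ∷ []) ∷ []) ≡
           bit (Subgraph.edge (Hs i) u v)
    read rewrite ≡i | ≡u | ≡v = ≡.trans (onNats (intact V) ℕ.≤-refl) (input-Hs i u v)
    inUnion : T (Subgraph.edge (Hs i) u v) → InUnion m'
    inUnion uv a b ab with adj-inv ab
    ... | inj₁ (inj₁ (≡.refl , ≡.refl)) = ∈-union i uv
    ... | inj₁ (inj₂ (≡.refl , ≡.refl)) = ∈-union i (≡.subst T (Subgraph.edge-sym (Hs i) u v) uv)
    ... | inj₂ ab′ = U a b ab′

  copying-set : ∀ {m} x j → T (6 <ᵇ x) → Copying m → Copying (setᴺ (x ∷ []) j m)
  copying-set {m} x j 6<x (V , U) = valid-agree A V , λ u v → U u v ∘ ≡.subst (λ z → T (1 ≤ᵇ z)) (onNats A ℕ.≤-refl)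
    where
    A : Agree 6 0 m (setᴺ (x ∷ []) j m)
    A = set-agree j 6<x

  ⊑-trans : ∀ {m m' m″} → m ⊑ m' → m' ⊑ m″ → m ⊑ m″
  ⊑-trans p q u v = q u v ∘ p u v

  copyEdges-spec : let m = exec copyEdges m₀ in Copying m × ContainsHs m
  copyEdges-spec = let C , _ , contains = loop₁ in C , contains
    where
    loop₃ : ∀ i u m → Copying m × nats m (8 ∷ []) ≡ toℕ i × nats m (9 ∷ []) ≡ toℕ u →
            let m' = exec (for 10 below cell 0 run copyEdge) m in
            (Copying m' × nats m' (8 ∷ []) ≡ toℕ i × nats m' (9 ∷ []) ≡ toℕ u) × m ⊑ m' ×
            (∀ v → T (Subgraph.edge (Hs i) u v) → T (adj m' u v))
    loop₃ i u m I@((V , _) , _) = for-each 10 (cell 0) copyEdge n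
      (λ m → Copying m × nats m (8 ∷ []) ≡ toℕ i × nats m (9 ∷ []) ≡ toℕ u) _⊑_
      (λ v m → T (Subgraph.edge (Hs i) u v) → T (adj m u v))
      (λ _ _ → id) (λ {m} {m'} {m″} → ⊑-trans {m} {m'} {m″}) (λ v ⊑ Q → ⊑ u v ∘ Q)
      (λ v m (C , ≡i , ≡u) → copyEdge-spec i u v ≡i ≡u ≡.refl (copying-set {m} 10 (toℕ v) tt C))
      m (n-cell (intact V)) I

    loop₂ : ∀ i m → Copying m × nats m (8 ∷ []) ≡ toℕ i →
            let m' = exec (for 9 below cell 0 run for 10 below cell 0 run copyEdge) m in
            (Copying m' × nats m' (8 ∷ []) ≡ toℕ i) × m ⊑ m' ×
            (∀ u v → T (Subgraph.edge (Hs i) u v) → T (adj m' u v))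
    loop₂ i m I@((V , _) , _) = for-each 9 (cell 0) (for 10 below cell 0 run copyEdge) n
      (λ m → Copying m × nats m (8 ∷ []) ≡ toℕ i) _⊑_
      (λ u m → ∀ v → T (Subgraph.edge (Hs i) u v) → T (adj m u v))
      (λ _ _ → id) (λ {m} {m'} {m″} → ⊑-trans {m} {m'} {m″}) (λ u ⊑ Q v → ⊑ u v ∘ Q v)
      (λ u m (C , ≡i) →
        let (C′ , ≡i′ , _) , ⊑ , Q = loop₃ i u (setᴺ (9 ∷ []) (toℕ u) m)
              (copying-set {m} 9 (toℕ u) tt C , ≡i , ≡.refl)
        in (C′ , ≡i′) , ⊑ , Q)
      m (n-cell (intact V)) I

    loop₁ : let m' = exec copyEdges m₀ in Copying m' × m₀ ⊑ m' × ContainsHs m'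
    loop₁ = for-each 8 (cell 1) (for 9 below cell 0 run for 10 below cell 0 run copyEdge) k
      Copying _⊑_ (λ i m → ∀ u v → T (Subgraph.edge (Hs i) u v) → T (adj m u v))
      (λ _ _ → id) (λ {m} {m'} {m″} → ⊑-trans {m} {m'} {m″}) (λ i ⊑ Q u v → ⊑ u v ∘ Q u v)
      (λ i m C → let (C′ , _) , ⊑ , Q = loop₂ i (setᴺ (8 ∷ []) (toℕ i) m)
                       (copying-set {m} 8 (toℕ i) tt C , ≡.refl)
                 in C′ , ⊑ , Q)
      m₀ ≡.refl
      (record { intact = agree-refl ; entry≤1 = λ _ _ → z≤n ; adj-sym = λ _ _ → ≡.refl ; adj-⊆ = λ _ _ () } ,
       λ _ _ ())

  -- Counting through a covering list makes the addition of an edge a matter of `_∷_`. The actual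
  -- `edgeCount` of the output enters only at the end, through `edgeCount-≤`.
  Covered : ℕ → Memory K → Set
  Covered b m = Σ[ L ∈ List (Fin n × Fin n) ]
    (∀ u v → toℕ u ℕ.< toℕ v → T (adj m u v) → (u , v) List.∈ L) × length L ℕ.≤ b

  covered-union : ∀ {m} → InUnion m → Covered (edgeCount union) m
  covered-union U = _ , (λ u v u<v uv →
    ∈-filter⁺ (λ (u , v) → T? ((toℕ u <ᵇ toℕ v) ∧ union u v)) (∈-cartesianProduct⁺ (∈-allFin u) (∈-allFin v))
      (Equivalence.from T-∧ (ℕ.<⇒<ᵇ u<v , U u v uv))) , ℕ.≤-refl

-- Growing the forests

module Forests {c ℓ₁ ℓ₂ : Level} (K : OrderedCommutativeRing c ℓ₁ ℓ₂) {n k : ℕ} (G : Graph K n)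
  (connected : IsConnected G) (Rs : Fin k → Subset n) (Rs-nonempty : ∀ i → Nonempty (Rs i))
  (Hs : Fin k → Subgraph G) where
  open OrderedCommutativeRing K using (Carrier; _+_; _≤_; 0#)
  private module K = OrderedCommutativeRing K
  open OrderedRing K using (≤-refl; ≤-trans; total; ≤-reflexive)
  open Graph G using (edge; weight; weight-nonNeg)
  open Memory
  open ProgramLogic K
  open Walks K G

  open Correctness K G Rs Hs
  open Valid

  module Round (i : Fin k) where
    open Dijkstra K weight (_∈ Rs i)

    S : Memory K → Fin n → Bool
    S m v = 1 ≤ᵇ nats m (7 ∷ toℕ v ∷ [])

    D : Memory K → Fin n → Carrier
    D m v = weights m (1 ∷ toℕ v ∷ [])

    nonNeg : ∀ {u v} → T (edge u v) → 0# ≤ weight u v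
    nonNeg {u} {v} = weight-nonNeg u v

    -- `adj m` also holds the copied edges and the earlier forests. They do no harm: `reachable`
    -- asks for some walk that is short enough, and `lower-bound` speaks of walks in `G`.
    Tree : Memory K → ℕ → Set (c ⊔ ℓ₂)
    Tree m r = Settled nonNeg (λ u v → T (adj m u v)) (S m) (D m) r

    reachable-all : ∀ v → ∃[ d ] Reach (λ u v → T (edge u v)) v d
    reachable-all v with Rs-nonempty i
    ... | r , r∈R = _ , walk⇒reach (whole G) (connected v r) r∈R

    Initial : Fin n → Memory K → Set c
    Initial v m = nats m (7 ∷ toℕ v ∷ []) ≡ bit (Vec.lookup (Rs i) v) × D m v ≡ 0#

    initialiseVertex-spec : ∀ j m → Agree 5 0 m₀ m × nats m (8 ∷ []) ≡ toℕ i →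
      let m' = exec initialiseVertex (setᴺ (10 ∷ []) (toℕ j) m) in
      (Agree 5 0 m₀ m' × nats m' (8 ∷ []) ≡ toℕ i) × (∀ v → Initial v m → Initial v m') × Initial j m'
    initialiseVertex-spec j m (A , ≡i) =
      (agree-trans A (agree-trans (set-agree (toℕ j) tt) (frame initialiseVertex m₁ tt)) , ≡i) ,
                          keep , here-initial
      where
      m₁ m₂ : Memory K
      m₁ = setᴺ (10 ∷ []) (toℕ j) m
      m₂ = exec initialiseVertex m₁
      r : ℕ
      r = evalᴺ m₁ (get (lit 3 ∷ cell 8 ∷ cell 10 ∷ []))
      here-initial : Initial j m₂
      here-initial = ≡.trans (update-same (nats m₁) {7 ∷ toℕ j ∷ []} r ≡.refl) read ,
                     update-same (weights m₁) 0# ≡.refl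
        where
        read : nats m (3 ∷ nats m (8 ∷ []) ∷ toℕ j ∷ []) ≡ bit (Vec.lookup (Rs i) j)
        read rewrite ≡i = ≡.trans (onNats A (s≤s (s≤s (s≤s z≤n)))) (input-R i j)
      keep : ∀ v → Initial v m → Initial v m₂
      keep v (p , q) with v Fin.≟ j
      ... | yes ≡.refl = here-initial
      ... | no  v≢j = ≡.trans (update-other (nats m₁) r (v≢j ∘ other {7})) p ,
                      ≡.trans (update-other (weights m₁) 0# (v≢j ∘ other)) q
        where
        other : ∀ {h} → (h ∷ toℕ j ∷ []) ≡ (h ∷ toℕ v ∷ []) → v ≡ j
        other eq = ≡.sym (Fin.toℕ-injective (∷-injectiveˡ (∷-injectiveʳ eq)))

    initialise-spec : ∀ m → Valid m → nats m (8 ∷ []) ≡ toℕ i →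
                      let m' = exec initialise m in Valid m' × m ⊑ m' × Tree m' n
    initialise-spec m V ≡i =
      valid-agree A V , (λ u v → ≡.subst (λ x → T (1 ≤ᵇ x)) (≡.sym (onNats A ℕ.≤-refl))) ,
      initially-settled nonNeg
        (λ {x} s → Vec.lookup⇒[]= x (Rs i) (Equivalence.to T-≡ (T-bit (proj₁ (initial x)) s)))
        (λ {x} x∈ → bit-T (proj₁ (initial x)) (≡.subst T (≡.sym (Vec.[]=⇒lookup x∈)) tt))
        (λ x → proj₂ (initial x)) ∈-allFin (ℕ.≤-reflexive (length-tabulate id))
      where
      A : Agree 6 0 m (exec initialise m)
      A = frame initialise m tt
      initial : ∀ v → Initial v (exec initialise m)
      -- Facts about vertices already initialised must survive, so the preorder given to `for-each`
      -- is preservation of these very facts.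
      initial = proj₂ (proj₂ (for-each 10 (cell 0) initialiseVertex n
        (λ m → Agree 5 0 m₀ m × nats m (8 ∷ []) ≡ toℕ i) (λ m m' → ∀ v → Initial v m → Initial v m')
        Initial (λ _ → id) (λ p q v → q v ∘ p v) (λ v ⊑ → ⊑ v)
        initialiseVertex-spec m (n-cell (intact V)) (intact V , ≡i)))

    -- Search for the crossing edge of least key

    module Scan (b : Memory K) (A : Agree 5 0 m₀ b) where

      Cross : Fin n → Fin n → Set
      Cross = Crossing nonNeg (S b)

      key : Fin n → Fin n → Carrier
      key x y = weight x y + D b y

      found : Memory K → Bool
      found m = 1 ≤ᵇ nats m (12 ∷ [])

      best : Memory K → Carrier
      best m = weights m (2 ∷ [])

      Best : Memory K → Set c
      Best m = ∃₂ λ x y → Cross x y × nats m (13 ∷ []) ≡ toℕ x × nats m (14 ∷ []) ≡ toℕ y × best m ≡ key x y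

      -- `b` stays fixed as the memory before the scan. Marks and distances lie in arrays that the
      -- scan leaves alone, so crossing edges and keys can be defined by `b` once and for all.
      Scanning : Memory K → Set c
      Scanning m = Agree 9 1 b m × (T (found m) → Best m)

      -- Once an edge is recorded, the record can only improve; this is what makes `Examined`
      -- persist.
      _≼_ : Memory K → Memory K → Set ℓ₂
      m ≼ m' = T (found m) → T (found m') × best m' ≤ best m

      ≼-refl : ∀ {m} → m ≼ m
      ≼-refl f = f , ≤-refl

      ≼-trans : ∀ {m m' m″} → m ≼ m' → m' ≼ m″ → m ≼ m″
      ≼-trans p q f = let f′ , ≤₁ = p f ; f″ , ≤₂ = q f′ in f″ , ≤-trans ≤₂ ≤₁

      Examined : Fin n → Fin n → Memory K → Set ℓ₂
      Examined x y m = Cross x y → T (found m) × best m ≤ key x y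

      examined-mono : ∀ x y {m m'} → m ≼ m' → Examined x y m → Examined x y m'
      examined-mono x y p q xy = let f , ≤₁ = q xy ; f′ , ≤₂ = p f in f′ , ≤-trans ≤₂ ≤₁

      examine-spec : ∀ {m} x y → nats m (10 ∷ []) ≡ toℕ x → nats m (11 ∷ []) ≡ toℕ y → Scanning m →
                     let m' = exec examine m in
                     (Scanning m' × nats m' (10 ∷ []) ≡ toℕ x) × m ≼ m' × Examined x y m'
      examine-spec {m} x y ≡x ≡y (B , wit) = if-elim Post isCrossing (ifᵖ hasBetter then skip else record-best) skip m
        (λ t → let xy = cross⁺ (≡.subst T test≡ t) in if-elim Post hasBetter skip record-best m
          (λ t′ → let f , b≤ = T-∧⁻ (found m) t′ in
             ((B , wit) , ≡x) , ≼-refl {m} , λ _ → f , ≡.subst (best m ≤_) key≡ (toWitness b≤))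
          (λ ¬t′ → ((agree-trans B (frame record-best m tt) , λ _ → x , y , xy , ≡x , ≡y , key≡) , ≡x) ,
             -- If an edge was recorded and the test still failed, totality puts the new key at or
             -- below the recorded one.
             (λ f → _ , [ (λ b≤ → ⊥-elim (¬t′ (Equivalence.from T-∧ (f , fromWitness b≤)))) , id ]′
                          (total (best m) (evalᵂ m keyᴱ))) ,
             λ _ → _ , ≤-reflexive (K.reflexive key≡)))
        (λ ¬t → ((B , wit) , ≡x) , ≼-refl {m} , λ xy → ⊥-elim (¬t (≡.subst T (≡.sym test≡) (cross⁻ xy))))
        where
        Post : Memory K → Set (c ⊔ ℓ₂)
        Post m' = (Scanning m' × nats m' (10 ∷ []) ≡ toℕ x) × m ≼ m' × Examined x y m'

        key≡ : evalᵂ m keyᴱ ≡ key x y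
        key≡ rewrite ≡x | ≡y = ≡.cong₂ _+_
          (≡.trans (onWeights B z≤n) (≡.trans (onWeights A z≤n) (input-weight x y)))
          (onWeights B ℕ.≤-refl)

        cross : Bool
        cross = not (S b x) ∧ (S b y ∧ (1 ≤ᵇ nats m₀ (2 ∷ toℕ x ∷ toℕ y ∷ [])))

        test≡ : evalTest m isCrossing ≡ cross
        test≡ rewrite ≡x | ≡y = ≡.cong₂ (λ p q → not (1 ≤ᵇ p) ∧ q)
          (onNats B 7≤9)
          (≡.cong₂ (λ p q → (1 ≤ᵇ p) ∧ (1 ≤ᵇ q)) (onNats B 7≤9)
            (≡.trans (onNats B (s≤s (s≤s z≤n))) (onNats A (s≤s (s≤s z≤n)))))
          where
          7≤9 : 7 ℕ.≤ 9
          7≤9 = ℕ.m≤n+m 7 2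

        cross⁺ : T cross → Cross x y
        cross⁺ t = let x∉ , t′ = T-∧⁻ (not (S b x)) t ; y∈ , xy = T-∧⁻ (S b y) t′ in
          T-not⁻ (S b x) x∉ , y∈ , T-bit (input-edge x y) xy

        cross⁻ : Cross x y → T cross
        cross⁻ (x∉ , y∈ , xy) = Equivalence.from T-∧ (T-not⁺ (S b x) x∉ ,
          Equivalence.from T-∧ (y∈ , bit-T (input-edge x y) xy))

      scan-spec : ∀ m → Scanning m → let m' = exec scan m in Scanning m' × (∀ x y → Examined x y m')
      scan-spec m I = let I′ , _ , Q = outer in I′ , Q
        where
        size : ∀ {m} → Agree 9 1 b m → nats m (0 ∷ []) ≡ n
        size B = ≡.trans (onNats B z≤n) (n-cell A)

        inner : ∀ x m → Scanning m × nats m (10 ∷ []) ≡ toℕ x →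
                let m' = exec (for 11 below cell 0 run examine) m in
                (Scanning m' × nats m' (10 ∷ []) ≡ toℕ x) × m ≼ m' × (∀ y → Examined x y m')
        inner x m I@((B , _) , _) = for-each 11 (cell 0) examine n
          (λ m → Scanning m × nats m (10 ∷ []) ≡ toℕ x) _≼_ (Examined x)
          (λ {m} → ≼-refl {m}) (λ {m} {m'} {m″} → ≼-trans {m} {m'} {m″}) (λ y {m} {m'} → examined-mono x y {m} {m'})
          (λ y m ((B , wit) , ≡x) → examine-spec {setᴺ (11 ∷ []) (toℕ y) m} x y ≡x ≡.refl
            (agree-trans B (set-agree (toℕ y) tt) , wit))
          m (size B) I

        outer : let m' = exec scan m in Scanning m' × m ≼ m' × (∀ x y → Examined x y m')
        outer = for-each 10 (cell 0) (for 11 below cell 0 run examine) n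
          Scanning _≼_ (λ x m → ∀ y → Examined x y m)
          (λ {m} → ≼-refl {m}) (λ {m} {m'} {m″} → ≼-trans {m} {m'} {m″})
          (λ x {m} {m'} p Q y → examined-mono x y {m} {m'} p (Q y))
          (λ x m (B , wit) →
            let (I′ , _) , p , Q = inner x (setᴺ (10 ∷ []) (toℕ x) m)
                                   ((agree-trans B (set-agree (toℕ x) tt) , wit) , ≡.refl)
            in I′ , p , Q)
          m (size (proj₁ I)) I

    -- A single step of growth, and the forest of one group

    Growing : ℕ → Memory K → ℕ → Memory K → Set (c ⊔ ℓ₂)
    Growing bound base r m = Valid m × base ⊑ m × Covered bound m × Tree m r

    module AfterScan {bound r : ℕ} {base b m : Memory K} (V : Valid b) (⊑b : base ⊑ b) (C : Covered bound b)
      (tree : Tree b (suc r)) (B : Agree 9 1 b m)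
      (examined : ∀ x y → Scan.Examined b (intact V) x y m) where
      open Scan b (intact V)

      valid-m : Valid m
      valid-m = valid-agree (agree-weaken (ℕ.m≤n+m 6 3) z≤n B) V

      ⊑m : b ⊑ m
      ⊑m u v = ≡.subst (λ x → T (1 ≤ᵇ x)) (≡.sym (onNats B (ℕ.m≤n+m 6 3)))

      m⊑ : m ⊑ b
      m⊑ u v = ≡.subst (λ x → T (1 ≤ᵇ x)) (onNats B (ℕ.m≤n+m 6 3))

      S≡ : ∀ v → S m v ≡ S b v
      S≡ v = ≡.cong (1 ≤ᵇ_) (onNats B (ℕ.m≤n+m 7 2))

      D≡ : ∀ v → D m v ≡ D b v
      D≡ v = onWeights B ℕ.≤-refl

      -- A complete scan without success means that no crossing edge exists, so by connectedness all
      -- vertices are settled. The two list entries allowed for the step remain as slack.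
      not-found : ¬ T (found m) → Growing (2 ℕ.+ bound) base r m
      not-found ¬f = valid-m , ⊑-trans {base} {b} {m} ⊑b ⊑m ,
        (proj₁ C , (λ u v u<v → proj₁ (proj₂ C) u v u<v ∘ m⊑ u v) , ℕ.m≤n⇒m≤o+n 2 (proj₂ (proj₂ C))) ,
        fully-settled nonNeg tree (λ {u} {v} → ⊑m u v) S≡ D≡ λ v →
          all-settled nonNeg tree (λ x y xy → ¬f (proj₁ (examined x y xy))) (proj₂ (reachable-all v))

      found-best : Best m → Growing (2 ℕ.+ bound) base r (exec settleBest m)
      found-best (x , y , xy , ≡x , ≡y , best≡) =
        valid (proj₂ (proj₂ xy)) (frame (addEdge 13 14) m₂ tt) (valid-agree A₂ valid-m) ,
        ⊑-trans {base} {b} {m'} ⊑b (⊑-trans {b} {m₂} {m'} ⊑m adj-mono) ,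
        -- Either endpoint may have the smaller number, so both orientations are listed; this is the
        -- origin of the constant 2 in the edge bound.
        ((x , y) ∷ (y , x) ∷ proj₁ C , cover′ , s≤s (s≤s (proj₂ (proj₂ C)))) ,
        settle nonNeg tree ≡.refl xy (λ x' y' xy' → ≡.subst (_≤ key x' y') best≡ (proj₂ (examined x' y' xy')))
          (λ {u} {v} → adj-mono u v ∘ ⊑m u v) adj-new
          (≡.subst (λ z → T (1 ≤ᵇ z)) (≡.sym (update-same (nats m) 1 (≡.cong (λ z → 7 ∷ z ∷ []) ≡x))) tt)
          (K.reflexive (≡.trans (update-same (weights m) (best m) (≡.cong (λ z → 1 ∷ z ∷ []) ≡x)) best≡))
          (λ v v≢x → ≡.trans (≡.cong (1 ≤ᵇ_) (update-other (nats m) 1 (v≢x ∘ other))) (S≡ v) ,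
                     ≡.trans (update-other (weights m) (best m) (v≢x ∘ other)) (D≡ v))
          Fin._≟_
        where
        m₂ : Memory K
        m₂ = exec markBest m
        A₂ : Agree 6 0 m m₂
        A₂ = frame markBest m tt
        m' : Memory K
        m' = exec (addEdge 13 14) m₂
        open EdgeAdded {m₂} {m'} {x} {y} (addEdge-spec {m₂} {x} {y} 13 14 ≡x ≡y)
        other : ∀ {h v} → (h ∷ nats m (13 ∷ []) ∷ []) ≡ (h ∷ toℕ v ∷ []) → v ≡ x
        other eq = Fin.toℕ-injective (≡.trans (≡.sym (∷-injectiveˡ (∷-injectiveʳ eq))) ≡x)
        cover′ : ∀ u v → toℕ u ℕ.< toℕ v → T (adj m' u v) → (u , v) List.∈ (x , y) ∷ (y , x) ∷ proj₁ C
        cover′ u v u<v uv with adj-inv uv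
        ... | inj₁ (inj₁ (≡.refl , ≡.refl)) = here ≡.refl
        ... | inj₁ (inj₂ (≡.refl , ≡.refl)) = there (here ≡.refl)
        ... | inj₂ uv′ = there (there (proj₁ (proj₂ C) u v u<v (m⊑ u v uv′)))

      settle-spec : (T (found m) → Best m) →
        Growing (2 ℕ.+ bound) base r (exec settleIfFound m)
      settle-spec wit = if-elim (Growing (2 ℕ.+ bound) base r) (isSet (lit 12 ∷ [])) settleBest skip m
        (λ f → found-best (wit f)) not-found

    growStep-spec : ∀ {bound base r} b → Growing bound base (suc r) b →
                    Growing (2 ℕ.+ bound) base r (exec growStep b)
    growStep-spec {bound} {base} {r} b (V , ⊑b , C , tree) =
      seq-intro Q ((lit 12 ∷ []) := lit 0) (scan ⨾ settleIfFound) b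
        (seq-intro Q scan settleIfFound b₁
          (AfterScan.settle-spec {base = base} {m = exec scan b₁} V ⊑b C tree
            (proj₁ (proj₁ scanned)) (proj₂ scanned) (proj₂ (proj₁ scanned))))
      where
      Q : Memory K → Set (c ⊔ ℓ₂)
      Q = Growing (2 ℕ.+ bound) base r
      b₁ : Memory K
      b₁ = setᴺ (12 ∷ []) 0 b
      scanned : Scan.Scanning b (intact V) (exec scan b₁) ×
                (∀ x y → Scan.Examined b (intact V) x y (exec scan b₁))
      -- With the flag cleared, the claim about a recorded edge holds vacuously.
      scanned = Scan.scan-spec b (intact V) b₁ (set-agree 0 tt , λ ())

    grow-spec : ∀ {bound} m → Growing bound m n m → let m' = exec grow m in
                Valid m' × m ⊑ m' × Covered (n ℕ.* 2 ℕ.+ bound) m' × ContainsForest (adj m') (Rs i)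
    grow-spec {bound} m I@(V , _) =
      let V′ , ⊑ , C , tree = grown in V′ , ⊑ , C , λ v →
      let s = none-remaining nonNeg (≡.subst (Tree (exec grow m)) (ℕ.n∸n≡0 n) tree) v
          d , reach , d≤ = Settled.reachable tree s
      in d , reach , λ r → ≤-trans d≤ (Settled.lower-bound tree s r)
      where
      grown : Growing (n ℕ.* 2 ℕ.+ bound) m (n ∸ n) (exec grow m)
      grown = for-invariant 9 (cell 0) growStep n
        (λ j → Growing (j ℕ.* 2 ℕ.+ bound) m (n ∸ j))
        (λ j m' (V , ⊑ , C , tree) →
          growStep-spec {toℕ j ℕ.* 2 ℕ.+ bound} {m} {n ∸ suc (toℕ j)} (setᴺ (9 ∷ []) (toℕ j) m')
          (valid-agree (set-agree (toℕ j) tt) V , ⊑ , C ,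
           -- `n ∸ toℕ j` is the successor of `n ∸ suc (toℕ j)`, the form that `growStep-spec`
           -- expects.
           ≡.subst (Tree (setᴺ (9 ∷ []) (toℕ j) m')) (ℕ.+-∸-assoc 1 (Fin.toℕ<n j)) tree))
        m (n-cell (intact V)) I

  -- Each of the `j` finished rounds contributes at most `n * 2` entries to the covering list, on
  -- top of the copied union.
  Grown : ℕ → Memory K → Set (c ⊔ ℓ₂)
  Grown j m = Valid m × ContainsHs m × Covered (j ℕ.* (n ℕ.* 2) ℕ.+ edgeCount union) m ×
              (∀ l → toℕ l ℕ.< j → ContainsForest (adj m) (Rs l))

  -- Later rounds only add edges, and the minimality clause of a forest speaks of `G` alone.
  forest-mono : ∀ {m m'} → m ⊑ m' → ∀ l → ContainsForest (adj m) (Rs l) → ContainsForest (adj m') (Rs l)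
  forest-mono p l forest v = let d , r , min = forest v in d , reach-mono (p _ _) r , min
    where open Dijkstra K weight (_∈ Rs l)

  round-spec : ∀ (i : Fin k) m → Grown (toℕ i) m →
               Grown (suc (toℕ i)) (exec (initialise ⨾ grow) (setᴺ (8 ∷ []) (toℕ i) m))
  round-spec i m (V , H⊆ , (L , cover , L≤) , forests) =
    let V₁ , p , tree = initialise-spec m₁ (valid-agree (set-agree (toℕ i) tt) V) ≡.refl
        V₂ , q , C , forest = grow-spec m₂
          (V₁ , (λ _ _ → id) , (L , (λ u v u<v → cover u v u<v ∘ unchanged u v) , L≤) , tree)
    in seq-intro (Grown (suc (toℕ i))) initialise grow m₁
         (V₂ , (λ j u v → q u v ∘ p u v ∘ H⊆ j u v) ,
          ≡.subst (λ b → Covered b m₃)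
            (≡.sym (ℕ.+-assoc (n ℕ.* 2) (toℕ i ℕ.* (n ℕ.* 2)) (edgeCount union))) C ,
          λ l l<si → [ (λ l<i → forest-mono {m₂} {m₃} q l (forest-mono {m₁} {m₂} p l (forests l l<i)))
                     , (λ l≡i → ≡.subst (λ l → ContainsForest (adj m₃) (Rs l))
                                             (≡.sym (Fin.toℕ-injective l≡i)) forest) ]′
                     (ℕ.m<1+n⇒m<n∨m≡n l<si))
    where
    open Round i
    m₁ m₂ m₃ : Memory K
    m₁ = setᴺ (8 ∷ []) (toℕ i) m
    m₂ = exec initialise m₁
    m₃ = exec grow m₂
    unchanged : m₂ ⊑ m
    unchanged u v = ≡.subst (λ x → T (1 ≤ᵇ x)) (onNats (frame {6} {0} initialise m₁ tt) ℕ.≤-refl)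

  growForests-spec : ∀ m → Grown 0 m → Grown k (exec growForests m)
  growForests-spec m I = for-invariant 8 (cell 1) (initialise ⨾ grow) k Grown round-spec m
    (k-cell (intact (proj₁ I))) I

  -- The final memory: output, size and running time

  final : Memory K
  final = exec algorithm m₀

  final-grown : Grown k final
  final-grown = seq-intro (Grown k) copyEdges growForests m₀
    (growForests-spec (exec copyEdges m₀)
      (let (V , U) , H⊆ = copyEdges-spec in V , H⊆ , covered-union {exec copyEdges m₀} U , λ _ ()))

  spanner : Subgraph G
  spanner = record
    { vertices = Subset.⊤
    ; edge     = adj final
    ; edge-sym = λ u v → ≡.cong (1 ≤ᵇ_) (adj-sym (proj₁ final-grown) u v)
    ; edge-end = λ _ _ _ → ∈⊤
    ; edge-⊆   = adj-⊆ (proj₁ final-grown)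
    }

  outputs-spanner : Outputs final spanner
  outputs-spanner = (λ _ → ∈⊤) , λ u v → bit-≤1 (entry≤1 (proj₁ final-grown) u v)
    where
    bit-≤1 : ∀ {x} → x ℕ.≤ 1 → x ≡ bit (1 ≤ᵇ x)
    bit-≤1 z≤n       = ≡.refl
    bit-≤1 (s≤s z≤n) = ≡.refl

  spanner-size : ∣ spanner ∣ᴱ ℕ.≤ 2 ℕ.* (n ℕ.* k ℕ.+ ∣⋃ Hs ∣ᴱ)
  spanner-size = begin
    edgeCount (adj final)         ≤⟨ edgeCount-≤ (adj final) L cover ⟩
    length L                      ≤⟨ L≤ ⟩
    k ℕ.* (n ℕ.* 2) ℕ.+ U         ≡⟨ ≡.cong (ℕ._+ U) (ℕ.*-assoc k n 2) ⟨
    k ℕ.* n ℕ.* 2 ℕ.+ U           ≡⟨ ≡.cong (ℕ._+ U) (ℕ.*-comm (k ℕ.* n) 2) ⟩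
    2 ℕ.* (k ℕ.* n) ℕ.+ U         ≡⟨ ≡.cong (λ x → 2 ℕ.* x ℕ.+ U) (ℕ.*-comm k n) ⟩
    2 ℕ.* (n ℕ.* k) ℕ.+ U         ≤⟨ ℕ.+-monoʳ-≤ (2 ℕ.* (n ℕ.* k)) (ℕ.m≤n*m U 2) ⟩
    2 ℕ.* (n ℕ.* k) ℕ.+ 2 ℕ.* U   ≡⟨ ℕ.*-distribˡ-+ 2 (n ℕ.* k) U ⟨
    2 ℕ.* (n ℕ.* k ℕ.+ U)         ∎
    where
    open ℕ.≤-Reasoning
    U : ℕ
    U = edgeCount union
    L : List (Fin n × Fin n)
    L = proj₁ (proj₁ (proj₂ (proj₂ final-grown)))
    cover : ∀ u v → toℕ u ℕ.< toℕ v → T (adj final u v) → (u , v) List.∈ L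
    cover = proj₁ (proj₂ (proj₁ (proj₂ (proj₂ final-grown))))
    L≤ : length L ℕ.≤ k ℕ.* (n ℕ.* 2) ℕ.+ U
    L≤ = proj₂ (proj₂ (proj₁ (proj₂ (proj₂ final-grown))))

  -- `n + k` bounds both loop limits and is positive because `k` is. The two syntactic checks on
  -- `algorithm` evaluate to true, hence `tt`.
  cost-polynomial : NonZero k → cost algorithm m₀ ℕ.≤ coefficient algorithm ℕ.* (n ℕ.+ k) ^ degree algorithm
  cost-polynomial k≢0 = cost-≤ (n ℕ.+ k) {{ℕ.>-nonZero (ℕ.<-≤-trans (ℕ.>-nonZero⁻¹ k {{k≢0}}) (ℕ.m≤n+m k n))}}
    {b = 0} algorithm m₀ tt tt (ℕ.m≤m+n n k , ℕ.m≤n+m k n)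

open import Data.Nat using (_+_; _*_; _≤_)

mainTheorem13 : ∀ {c ℓ₁ ℓ₂ : Level} →
    Σ[ P ∈ Program ] Σ[ A ∈ ℕ ] Σ[ D ∈ ℕ ] Σ[ C ∈ ℕ ]
    (∀ (K : OrderedCommutativeRing c ℓ₁ ℓ₂) (let module K = OrderedCommutativeRing K)
    (n k : ℕ) → NonZero k →
    (G : Graph K n) → IsConnected G →
    (Rs : Fin k → Subset n) → (∀ i → Nonempty (Rs i)) →
    (α : K.Carrier) → K.1# K.≤ α →
    (Hs : Fin k → Subgraph G) → (∀ i → IsSubsetwiseSpanner G α (Rs i) (Hs i)) →
    cost P (input Rs Hs) ≤ A * (n + k) ^ D ×
    Σ[ H ∈ Subgraph G ]
    (Outputs (exec P (input Rs Hs)) H ×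
    IsGroupSteinerSpanner G ((K.1# K.+ K.1#) K.* α K.+ K.1#) Rs H ×
    ∣ H ∣ᴱ ≤ C * (n * k + ∣⋃ Hs ∣ᴱ)))
mainTheorem13 = algorithm , coefficient algorithm , degree algorithm , 2 ,
  λ K n k k≢0 G connected Rs Rs-nonempty α 1≤α Hs spanners →
    let open Forests K G connected Rs Rs-nonempty Hs
        _ , Hs⊆ , _ , forests = final-grown
    in cost-polynomial k≢0 , spanner , outputs-spanner ,
       Spanner.isGroupSteinerSpanner K G connected Rs Rs-nonempty α 1≤α Hs spanners
         -- The first group, which exists as `k` is non-zero, guarantees a terminal on every group
         -- Steiner walk, so that there is a place to start cutting.
         (fromℕ< (ℕ.>-nonZero⁻¹ k {{k≢0}})) spanner (λ _ → ∈⊤) Hs⊆ (λ i → forests i (Fin.toℕ<n i)) ,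
       spanner-size
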